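{- Let $k\ge 1$ and $n\ge 3$ be integers, and let $G$ be a complete graph with $|G|\ge n$ whose edges are colored by a Gallai $k$-coloring with color classes $E_1,\ldots,E_k$. Let $q(G)$ denote the number of colors $i\in[k]$ such that the spanning subgraph $H_i$ of $G$ with $V(H_i)=V(G)$ and $E(H_i)=E_i$ has a connected component with at least $n$ vertices. If $|G|\ge (n-1)\cdot q(G)+2n+2$, then $G$ contains a monochromatic cycle $C_{2n}$ (a cycle on $2n$ vertices all of whose edges have the same color).
   Context: A Gallai coloring of a complete graph is an edge-coloring with no rainbow triangle, i.e., no triangle whose three edges receive three distinct colors. A Gallai $k$-coloring is a Gallai coloring using (at most) the colors in $[k]=\{1,\ldots,k\}$. $|G|$ denotes the number of vertices of $G$, and $C_m$ denotes the cycle on $m$ vertices. -}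

module Defs where

open import Data.Nat using (ℕ; zero; suc)
open import Data.Fin using (Fin; toℕ)
open import Data.Product using (Σ; _×_; ∃)
open import Data.Sum using (_⊎_)
open import Relation.Binary.PropositionalEquality using (_≡_; _≢_)
open import Relation.Nullary using (¬_)
open import Function.Definitions using (Injective)

-- An edge-coloring of the complete graph on vertex set Fin N with colors Fin k:
-- a function on ordered pairs, required to be symmetric on distinct pairs
-- (values on the diagonal are irrelevant: there are no loops).
Coloring : ℕ → ℕ → Set
Coloring N k = Fin N → Fin N → Fin k

Symmetric : ∀ {N k} → Coloring N k → Set
Symmetric {N} c = ∀ (x y : Fin N) → x ≢ y → c x y ≡ c y x

Gallai : ∀ {N k} → Coloring N k → Set
Gallai {N} c = ∀ (x y z : Fin N) → x ≢ y → y ≢ z → x ≢ z →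
  ¬ (c x y ≢ c y z × c y z ≢ c x z × c x y ≢ c x z)

data Reach {N k} (c : Coloring N k) (i : Fin k) : Fin N → Fin N → Set where
  here : ∀ {x} → Reach c i x x
  step : ∀ {x y z} → x ≢ y → c x y ≡ i → Reach c i y z → Reach c i x z

HasBigComponent : ∀ {N k} → Coloring N k → ℕ → Fin k → Set
HasBigComponent {N} c n i =
  Σ (Fin N) λ v → Σ (Fin n → Fin N) λ f → Injective _≡_ _≡_ f × (∀ j → Reach c i v (f j))

MonoCycle : ∀ {N k} → Coloring N k → ℕ → Set
MonoCycle {N} {k} c L =
  Σ (Fin k) λ i → Σ (Fin L → Fin N) λ f → Injective _≡_ _≡_ f ×
    (∀ (j j' : Fin L) →
       (suc (toℕ j) ≡ toℕ j' ⊎ (suc (toℕ j) ≡ L × toℕ j' ≡ 0)) →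
       c (f j) (f j') ≡ i)

{-# OPTIONS --safe #-}
-- Call a set of vertices a module if every outside vertex is joined to it in a
-- single colour. By Gallai's theorem (some two colours contain all edges across
-- some cut) a minimal module H with at least n vertices splits into parts with
-- fewer than n vertices, with at most two colours i, j between parts. For each
-- colour l, fewer than n outside vertices are joined to H in colour l (otherwise
-- l contains K_{n,n}), and there are none unless l counts for q(G). Hence if only
-- one colour occurs between the parts, H has at least 2n + 2 vertices and is
-- complete multipartite in it; otherwise i and j both span H, and H together with
-- the vertices joined to it in colour i or j is a set X of at least 4n vertices.
--
-- In X, regard vertices in the same part as non-adjacent twins. Starting from a
-- monochromatic C_4, a monochromatic (say red) C_{2m} with m < n is lengthened by
-- two. Let Y be the set of the at least 2m + 4 vertices off the cycle. If two of
-- them cannot be inserted into the cycle, then two vertices y, y' of Y (with at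
-- most one exception) have at most m + 1 red neighbours on the cycle between them,
-- and at most m if yy' is not blue; so they have at least m - 1, respectively m,
-- common blue neighbours there. Two blue edges in Y plus one non-blue pair, or a
-- blue path with four edges, can therefore be completed greedily to a blue
-- C_{2m+2}; if Y has at most one blue edge, it contains a red C_{2m+2} because it
-- is almost complete multipartite in red. Vertices of Y with a twin on the cycle
-- are joined in blue to all of Y except their twins, which only helps.

module Submission where

open import Defs
open import Data.Nat using (ℕ; zero; suc; _+_; _*_; _∸_; _≤_; _<_; z≤n; s≤s; _≤?_)
open import Data.Nat.Properties
open import Data.Nat.Tactic.RingSolver using (solve-∀)
open import Data.Fin using (Fin; zero; suc; toℕ; inject≤)
import Data.Fin.Properties as Fin
open import Data.Fin.Subset using (Subset; _∈_; ∣_∣; inside; outside)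
open import Data.Bool using (Bool; true; false; not)
open import Data.List using (List; []; _∷_; _++_; _∷ʳ_; length; filter; reverse; take; map; allFin; lookup; [_])
open import Data.List.Properties using (length-++; length-tabulate; ++-assoc; unfold-reverse; length-map)
open import Data.List.Membership.Propositional using (_∉_; find; lose) renaming (_∈_ to _∈ˡ_)
open import Data.List.Membership.Propositional.Properties using
  (∈-map⁺; ∈-map⁻; ∈-filter⁺; ∈-filter⁻; ∈-++⁺ˡ; ∈-++⁺ʳ; ∈-++⁻; ∈-allFin; ∈-∃++; ∈-lookup)
open import Data.List.Relation.Unary.All as All using (All; []; _∷_)
open import Data.List.Relation.Unary.Any as Any using (Any; here; there; any?)
open import Data.List.Relation.Unary.AllPairs using (AllPairs; []; _∷_)
open import Data.List.Relation.Unary.Unique.Propositional using (Unique)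
import Data.List.Relation.Unary.Unique.Propositional.Properties as Uniq
open import Data.List.Relation.Binary.Permutation.Propositional as ↭ using (_↭_; prep; swap; ↭-refl; ↭-sym; ↭-trans; ↭-reflexive)
import Data.List.Relation.Binary.Permutation.Propositional.Properties as Perm
open import Data.List.Relation.Unary.Linked.Properties using (Linked⇒AllPairs)
import Data.List.Sort as Sort
import Data.Vec as Vec
open import Data.Product using (∃; _×_; _,_; proj₁; proj₂)
open import Data.Sum using (_⊎_; inj₁; inj₂; [_,_]′)
open import Data.Unit using (⊤)
open import Data.Empty using (⊥; ⊥-elim)
open import Function using (_∘_; id; case_of_)
open import Function.Bundles using (_⇔_; Equivalence)
open import Relation.Nullary using (¬_; Dec; does; yes; no; ¬?; contradiction)
open import Relation.Nullary.Decidable using (_×-dec_; _⊎-dec_; decidable-stable; dec-true; dec-false)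
open import Relation.Binary.Definitions using (DecidableEquality)
open import Relation.Binary.PropositionalEquality hiding ([_])
import Relation.Binary.Construct.On as On
import Relation.Unary as U


-- Duplicate-free lists: counting and greedy choice.

private variable
  A : Set
  x y : A
  xs ys : List A

Unique-↭ : xs ↭ ys → Unique xs → Unique ys
Unique-↭ ↭.refl u = u
Unique-↭ (prep _ p) (a ∷ u) = Perm.All-resp-↭ p a ∷ Unique-↭ p u
Unique-↭ (swap _ _ p) ((n ∷ a) ∷ b ∷ u) =
  (n ∘ sym ∷ Perm.All-resp-↭ p b) ∷ Perm.All-resp-↭ p a ∷ Unique-↭ p u
Unique-↭ (↭.trans p q) u = Unique-↭ q (Unique-↭ p u)

remove-∈ : x ∈ˡ ys → ∃ λ zs → ys ↭ x ∷ zs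
remove-∈ p with ∈-∃++ p
... | as , bs , refl = as ++ bs , Perm.shift _ as bs

unique-⊆-length : Unique xs → (∀ {z} → z ∈ˡ xs → z ∈ˡ ys) → length xs ≤ length ys
unique-⊆-length {xs = []} _ _ = z≤n
unique-⊆-length {xs = x ∷ xs} {ys} (x∉ ∷ u) sub with remove-∈ (sub (here refl))
... | zs , ys↭ = subst (suc (length xs) ≤_) (sym (Perm.↭-length ys↭)) (s≤s (unique-⊆-length u sub′))
  where
  sub′ : ∀ {z} → z ∈ˡ xs → z ∈ˡ zs
  sub′ z∈ with Perm.∈-resp-↭ ys↭ (sub (there z∈))
  ... | here refl = ⊥-elim (All.lookup x∉ z∈ refl)
  ... | there q = q

module _ {P : A → Set} (P? : U.Decidable P) where

  filter-++¬ : ∀ xs → length (filter P? xs) + length (filter (¬? ∘ P?) xs) ≡ length xs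
  filter-++¬ [] = refl
  filter-++¬ (x ∷ xs) with P? x
  ... | yes _ = cong suc (filter-++¬ xs)
  ... | no _ = trans (+-suc _ _) (cong suc (filter-++¬ xs))

  filter-⊆ : ∀ {xs x} → x ∈ˡ filter P? xs → x ∈ˡ xs
  filter-⊆ = proj₁ ∘ ∈-filter⁻ P?

  filter-holds : ∀ {xs x} → x ∈ˡ filter P? xs → P x
  filter-holds {xs} = proj₂ ∘ ∈-filter⁻ P? {xs = xs}

module _ (_≟_ : DecidableEquality A) where
  open import Data.List.Membership.DecPropositional _≟_ using (_∈?_)

  pick : ∀ (xs ys : List A) → Unique xs → length ys < length xs → ∃ λ x → x ∈ˡ xs × x ∉ ys
  pick xs ys u lt with any? (λ z → ¬? (z ∈? ys)) xs
  ... | yes p = find p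
  ... | no ¬p = contradiction
    (unique-⊆-length u λ {z} z∈ → decidable-stable (z ∈? ys) λ z∉ → ¬p (lose z∈ z∉))
    (<⇒≱ lt)

  pick-many : ∀ k (xs ys : List A) → Unique xs → length ys + k ≤ length xs →
    ∃ λ zs → length zs ≡ k × Unique zs × (∀ {z} → z ∈ˡ zs → z ∈ˡ xs × z ∉ ys)
  pick-many zero xs ys u le = [] , refl , [] , λ ()
  pick-many (suc k) xs ys u le
    with pick xs ys u (≤-trans (s≤s (m≤m+n _ k)) (≤-trans (≤-reflexive (sym (+-suc _ k))) le))
  ... | x , x∈ , x∉
    with pick-many k xs (x ∷ ys) u (≤-trans (≤-reflexive (sym (+-suc _ k))) le)
  ... | zs , len , uz , h = x ∷ zs , cong suc len
    , All.tabulate (λ z∈ x≡z → proj₂ (h z∈) (here (sym x≡z))) ∷ uz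
    , λ { (here refl) → x∈ , x∉ ; (there z∈) → proj₁ (h z∈) , proj₂ (h z∈) ∘ there }

Unique-∷ : x ∉ xs → Unique xs → Unique (x ∷ xs)
Unique-∷ x∉ u = All.tabulate (λ { z∈ refl → x∉ z∈ }) ∷ u

head∉ : Unique (x ∷ xs) → x ∉ xs
head∉ (p ∷ _) x∈ = All.lookup p x∈ refl

Unique-++ : Unique xs → Unique ys → (∀ {z} → z ∈ˡ xs → z ∉ ys) → Unique (xs ++ ys)
Unique-++ ux uy d = Uniq.++⁺ ux uy λ (p , q) → d p q

-- Walks and cycles

-- Only interior vertices are listed, so the vertices of a closed walk from `x` are exactly
-- `x ∷ ys`, the list that `Cycle` requires to be duplicate-free.
Walk : (A → A → Set) → A → List A → A → Set
Walk R x [] z = R x z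
Walk R x (y ∷ ys) z = R x y × Walk R y ys z

lst : A → List A → A
lst x [] = x
lst x (y ∷ ys) = lst y ys

lst-++ : ∀ (x : A) ys h zs → lst x (ys ++ h ∷ zs) ≡ lst h zs
lst-++ x [] h zs = refl
lst-++ x (y ∷ ys) h zs = lst-++ y ys h zs

module _ {R : A → A → Set} where

  walk-++ : ∀ x ys h zs {z} → Walk R x ys h → Walk R h zs z → Walk R x (ys ++ h ∷ zs) z
  walk-++ x [] h zs r w = r , w
  walk-++ x (y ∷ ys) h zs (r , v) w = r , walk-++ y ys h zs v w

  walk-split : ∀ x ys h zs {z} → Walk R x (ys ++ h ∷ zs) z → Walk R x ys h × Walk R h zs z
  walk-split x [] h zs (r , w) = r , w
  walk-split x (y ∷ ys) h zs (r , w) with walk-split y ys h zs w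
  ... | a , b = (r , a) , b

  walk-end : ∀ x ys {z z′} → Walk R x ys z → R (lst x ys) z′ → Walk R x ys z′
  walk-end x [] _ r = r
  walk-end x (y ∷ ys) (p , w) r = p , walk-end y ys w r

  walk-last : ∀ x ys {z} → Walk R x ys z → R (lst x ys) z
  walk-last x [] r = r
  walk-last x (y ∷ ys) (_ , w) = walk-last y ys w

  walk-rev : (∀ {a b} → R a b → R b a) → ∀ x ys {z} → Walk R x ys z → Walk R z (reverse ys) x
  walk-rev s x [] r = s r
  walk-rev s x (y ∷ ys) {z} (r , w) = subst (λ l → Walk R z l x) (sym (unfold-reverse y ys))
    (walk-++ z (reverse ys) y [] (walk-rev s y ys w) (s r))

record Cycle (R : A → A → Set) (k : ℕ) : Set where
  constructor mkCycle
  field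
    hd : A
    tl : List A
    len : suc (length tl) ≡ k
    unique : Unique (hd ∷ tl)
    walk : Walk R hd tl hd

module _ {P : A → A → Set} (P? : ∀ a b → Dec (P a b)) where

  -- The indicator of a step is the length of a filtered singleton, so a case split on `P?`
  -- evaluates it. `P` is read in the direction of the walk and need not be symmetric.
  edges : A → List A → A → ℕ
  edges x [] z = length (filter (λ w → P? w z) [ x ])
  edges x (y ∷ ys) z = length (filter (λ w → P? w y) [ x ]) + edges y ys z

  edges-one : ∀ x ys z → 1 ≤ edges x ys z →
    (∃ λ as → ∃ λ d → ∃ λ bs → ys ≡ as ++ d ∷ bs × P (lst x as) d) ⊎ P (lst x ys) z
  edges-one x [] z h with P? x z
  ... | yes p = inj₂ p
  edges-one x (y ∷ ys) z h with P? x y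
  ... | yes p = inj₁ ([] , y , ys , refl , p)
  ... | no _ with edges-one y ys z h
  ... | inj₁ (as , d , bs , eq , p) = inj₁ (y ∷ as , d , bs , cong (y ∷_) eq , p)
  ... | inj₂ p = inj₂ p

  edges-two : ∀ x ys z → 2 ≤ edges x ys z →
    ∃ λ as → ∃ λ d → ∃ λ bs → ys ≡ as ++ d ∷ bs × P (lst x as) d × 1 ≤ edges d bs z
  edges-two x [] z h with P? x z
  edges-two x [] z (s≤s ()) | yes _
  edges-two x (y ∷ ys) z h with P? x y
  ... | yes p = [] , y , ys , refl , p , s≤s⁻¹ h
    where s≤s⁻¹ = ≤-pred
  ... | no _ with edges-two y ys z h
  ... | as , d , bs , eq , p , q = y ∷ as , d , bs , cong (y ∷_) eq , p , q

  edges-last : ∀ x ys z → P (lst x ys) z → 1 ≤ edges x ys z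
  edges-last x [] z p with P? x z
  ... | yes _ = s≤s z≤n
  ... | no ¬p = ⊥-elim (¬p p)
  edges-last x (y ∷ ys) z p = ≤-trans (edges-last y ys z p) (m≤n+m _ _)

  edges-++ : ∀ x as d bs z → edges x (as ++ d ∷ bs) z ≡ edges x as d + edges d bs z
  edges-++ x [] d bs z = refl
  edges-++ x (a ∷ as) d bs z = trans (cong (e +_) (edges-++ a as d bs z)) (sym (+-assoc e _ _))
    where e = length (filter (λ w → P? w a) [ x ])

-- The closed walk x , ys rotated to start at d and cut into two walks, from d to h and from h to d.
record Rotation (x : A) (ys : List A) (d : A) (as : List A) (h : A) (bs : List A) : Set₁ where
  field
    perm : (d ∷ as ++ h ∷ bs) ↭ (x ∷ ys)
    walks : ∀ {R : A → A → Set} → Walk R x ys x → Walk R d as h × Walk R h bs d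
    edges-≡ : ∀ {P : A → A → Set} (P? : ∀ a b → Dec (P a b)) → edges P? x ys x ≡ edges P? d as h + edges P? h bs d

rotation₁ : ∀ (x : A) as d bs → Rotation x (as ++ d ∷ bs) d bs x as
rotation₁ x as d bs = record
  { perm = Perm.++-comm (d ∷ bs) (x ∷ as)
  ; walks = λ w → let (u , v) = walk-split x as d bs w in v , u
  ; edges-≡ = λ P? → trans (edges-++ P? x as d bs x) (+-comm (edges P? x as d) _) }

rotation₂ : ∀ (x : A) as d cs h bs → Rotation x (as ++ d ∷ cs ++ h ∷ bs) d cs h (bs ++ x ∷ as)
rotation₂ x as d cs h bs = record
  { perm = ↭-trans (↭-reflexive (sym (++-assoc (d ∷ cs) (h ∷ bs) (x ∷ as)))) (Perm.++-comm (d ∷ cs ++ h ∷ bs) (x ∷ as))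
  ; walks = λ w → let (u , v) = walk-split x as d _ w ; (v₁ , v₂) = walk-split d cs h bs v
                  in v₁ , walk-++ h bs x as v₂ u
  ; edges-≡ = λ P? → trans (edges-++ P? x as d (cs ++ h ∷ bs) x)
      (trans (cong (edges P? x as d +_) (edges-++ P? d cs h bs x))
      (trans (lem (edges P? x as d) (edges P? d cs h) (edges P? h bs x))
        (cong (edges P? d cs h +_) (sym (edges-++ P? h bs x as d))))) }
  where
  lem : ∀ a b c → a + (b + c) ≡ b + (c + a)
  lem = solve-∀

rotation-swap : ∀ {x : A} {ys d as h bs} → Rotation x ys d as h bs → Rotation x ys h bs d as
rotation-swap {d = d} {as} {h} {bs} r = record
  { perm = ↭-trans (Perm.++-comm (h ∷ bs) (d ∷ as)) perm
  ; walks = λ w → let (u , v) = walks w in v , u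
  ; edges-≡ = λ P? → trans (edges-≡ P?) (+-comm (edges P? d as h) _) }
  where open Rotation r

-- Brings a chosen step of the first walk to its end, which is where `insert-two` expects it.
rotation-shift : ∀ {x : A} {ys d as e cs h bs} → Rotation x ys d (as ++ e ∷ cs) h bs → Rotation x ys d as e (cs ++ h ∷ bs)
rotation-shift {d = d} {as} {e} {cs} {h} {bs} r = record
  { perm = ↭-trans (↭-reflexive (cong (d ∷_) (sym (++-assoc as (e ∷ cs) (h ∷ bs))))) perm
  ; walks = λ w → let (u , v) = walks w ; (u₁ , u₂) = walk-split d as e cs u in u₁ , walk-++ e cs h bs u₂ v
  ; edges-≡ = λ P? → trans (edges-≡ P?) (trans (cong (_+ edges P? h bs d) (edges-++ P? d as e cs h))
      (trans (+-assoc (edges P? d as e) _ _) (cong (edges P? d as e +_) (sym (edges-++ P? e cs h bs d))))) }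
  where open Rotation r

-- The cuts are placed right after the two steps in `P`, so each of the two walks ends with one of
-- them.
two-edges : ∀ {P : A → A → Set} (P? : ∀ a b → Dec (P a b)) x ys → 2 ≤ edges P? x ys x →
  ∃ λ d → ∃ λ as → ∃ λ h → ∃ λ bs → Rotation x ys d as h bs × P (lst h bs) d × P (lst d as) h
two-edges {P = P} P? x ys h with edges-two P? x ys x h
... | as , d , bs , refl , p , q with edges-one P? d bs x q
... | inj₂ p′ = d , bs , x , as , rotation₁ x as d bs , p , p′
... | inj₁ (cs , h′ , bs′ , refl , p′) = d , cs , h′ , bs′ ++ x ∷ as , rotation₂ x as d cs h′ bs′ ,
  subst (λ t → P t d) (sym (lst-++ h′ bs′ x as)) p , p′

-- Even cycles in complete bipartite and multipartite graphs.

alternate : List A → List A → List A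
alternate (a ∷ as) (b ∷ bs) = a ∷ b ∷ alternate as bs
alternate _ _ = []

alternate-↭ : ∀ (as bs : List A) → length as ≡ length bs → alternate as bs ↭ as ++ bs
alternate-↭ [] [] _ = ↭-refl
alternate-↭ (a ∷ as) (b ∷ bs) eq =
  prep a (↭-trans (prep b (alternate-↭ as bs (suc-injective eq))) (↭-sym (Perm.shift b as bs)))

module _ {R : A → A → Set} where

  alternate-cross : (∀ {x y} → R x y → R y x) → ∀ a as b bs {z} → length as ≡ length bs →
    (∀ {x y} → x ∈ˡ a ∷ as → y ∈ˡ b ∷ bs → R x y) → (∀ {y} → y ∈ˡ b ∷ bs → R y z) →
    Walk R a (b ∷ alternate as bs) z
  alternate-cross s a [] b [] eq c e = c (here refl) (here refl) , e (here refl)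
  alternate-cross s a (a′ ∷ as) b (b′ ∷ bs) eq c e =
    c (here refl) (here refl) , s (c (there (here refl)) (here refl)) ,
    alternate-cross s a′ as b′ bs (suc-injective eq) (λ p q → c (there p) (there q)) (e ∘ there)

  bipartite-cycle : (∀ {x y} → R x y → R y x) → ∀ a as b bs → length as ≡ length bs →
    (∀ {x y} → x ∈ˡ a ∷ as → y ∈ˡ b ∷ bs → R x y) → Unique (a ∷ as ++ b ∷ bs) →
    Cycle R (2 * suc (length as))
  bipartite-cycle s a as b bs eq c u = mkCycle a (b ∷ alternate as bs)
    (trans (Perm.↭-length perm) (trans (cong suc (length-++ as)) (trans (cong (λ t → suc (length as + suc t)) (sym eq)) (lem (length as)))))
    (Unique-↭ (↭-sym perm) u) (alternate-cross s a as b bs eq c λ q → s (c (here refl) q))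
    where
    perm : alternate (a ∷ as) (b ∷ bs) ↭ a ∷ as ++ b ∷ bs
    perm = alternate-↭ (a ∷ as) (b ∷ bs) (cong suc eq)
    lem : ∀ t → suc (t + suc t) ≡ 2 * suc t
    lem = solve-∀

  -- Entries at least `m` places apart are adjacent; `suc (length q)` is the distance from `x` to
  -- `y`.
  Far : ℕ → List A → Set
  Far m [] = ⊤
  Far m (x ∷ l) = (∀ q y r → l ≡ q ++ y ∷ r → m ≤ suc (length q) → R x y) × Far m l

  -- `pre` collects the entries of the second block already visited. By the invariant
  -- `length as + length pre ≡ m`, each step before the last goes `m + 1` places forwards or `m`
  -- places backwards.
  alternate-far : (∀ {x y} → R x y → R y x) → ∀ m a as pre b bs rest {z} → length as ≡ length bs →
    length as + length pre ≡ m → Far m (a ∷ as ++ pre ++ b ∷ bs ++ rest) → R (lst b bs) z →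
    Walk R a (b ∷ alternate as bs) z
  alternate-far s m a [] pre b [] rest eq len (f , _) e = f pre b rest refl (≤-trans (≤-reflexive (sym len)) (n≤1+n _)) , e
  alternate-far s m a (a′ ∷ as) pre b (b′ ∷ bs) rest eq len (f , f′ , F) e =
    f (a′ ∷ as ++ pre) b (b′ ∷ bs ++ rest) (cong (a′ ∷_) (sym (++-assoc as pre _)))
      (≤-trans (≤-reflexive (sym len)) (s≤s (≤-trans (≤-reflexive (sym (length-++ as))) (n≤1+n _)))) ,
    s (f′ (as ++ pre) b (b′ ∷ bs ++ rest) (sym (++-assoc as pre _))
      (≤-trans (≤-reflexive (sym len)) (s≤s (≤-reflexive (sym (length-++ as)))))) ,
    alternate-far s m a′ as (pre ++ [ b ]) b′ bs rest (suc-injective eq)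
      (trans (cong (length as +_) (trans (length-++ pre) (+-comm _ 1))) (trans (+-suc _ _) len))
      (subst (Far m) (cong (λ t → a′ ∷ as ++ t) (sym (++-assoc pre [ b ] _))) (f′ , F)) e

count-prefix : ∀ {P : A → Set} (P? : U.Decidable P) {xs ys} → All P xs → length xs ≤ length (filter P? (xs ++ ys))
count-prefix P? {[]} _ = z≤n
count-prefix P? {x ∷ xs} (px ∷ pxs) with P? x
... | yes _ = s≤s (count-prefix P? pxs)
... | no ¬p = ⊥-elim (¬p px)

count-tail : ∀ {P : A → Set} (P? : U.Decidable P) x xs → length (filter P? xs) ≤ length (filter P? (x ∷ xs))
count-tail P? x xs with P? x
... | yes _ = n≤1+n _
... | no _ = ≤-refl

lst-split : ∀ (x : A) xs → ∃ λ is → x ∷ xs ≡ is ++ [ lst x xs ] × length is ≡ length xs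
lst-split x [] = [] , refl , refl
lst-split x (y ∷ xs) with lst-split y xs
... | is , eq , len = x ∷ is , cong (x ∷_) eq , cong suc len

split-at : ∀ k (xs : List A) → k ≤ length xs → ∃ λ as → ∃ λ bs → xs ≡ as ++ bs × length as ≡ k
split-at zero xs _ = [] , xs , refl , refl
split-at (suc k) (x ∷ xs) (s≤s h) with split-at k xs h
... | as , bs , refl , refl = x ∷ as , bs , refl , refl

module _ (key : A → ℕ) where

  ClassesAtMost : ℕ → List A → Set
  ClassesAtMost m xs = ∀ k → length (filter (λ v → key v ≟ k) xs) ≤ m

  private
    O = On.decTotalOrder ≤-decTotalOrder key
    Ord : A → A → Set
    Ord x y = key x ≤ key y

  classes-↭ : ∀ {m xs ys} → xs ↭ ys → ClassesAtMost m xs → ClassesAtMost m ys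
  classes-↭ p c k = ≤-trans (≤-reflexive (sym (Perm.↭-length (Perm.filter-↭ (λ v → key v ≟ k) p)))) (c k)

  module _ {R : A → A → Set} where

    -- In sorted order equal keys are contiguous, so two of them at distance at least `m` would
    -- enclose a class of more than `m` entries.
    sorted-far : ∀ m xs → AllPairs Ord xs → ClassesAtMost m xs →
      (∀ {x y} → x ∈ˡ xs → y ∈ˡ xs → key x ≢ key y → R x y) → Far {R = R} m xs
    sorted-far m [] _ _ _ = _
    sorted-far m (x ∷ l) (x≤ ∷ s) c r =
      (λ { q y rr refl m≤ → r (here refl) (there (∈-++⁺ʳ q (here refl))) λ kx≡ky →
          <⇒≱ (s≤s m≤) (≤-trans (block q y rr x≤ s kx≡ky) (c (key x))) }) ,
      sorted-far m l s (λ k → ≤-trans (count-tail _ x l) (c k)) (λ p q → r (there p) (there q))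
      where
      low : ∀ q y rr → AllPairs Ord (q ++ y ∷ rr) → All (λ z → key z ≤ key y) q
      low [] y rr _ = []
      low (z ∷ q) y rr (a ∷ s) = All.lookup a (∈-++⁺ʳ q (here refl)) ∷ low q y rr s
      block : ∀ q y rr → All (λ z → key x ≤ key z) (q ++ y ∷ rr) → AllPairs Ord (q ++ y ∷ rr) → key x ≡ key y →
        suc (suc (length q)) ≤ length (filter (λ v → key v ≟ key x) (x ∷ q ++ y ∷ rr))
      block q y rr a s e = subst₂ _≤_ (cong suc (trans (length-++ q) (+-comm _ 1)))
        (cong (λ t → length (filter (λ v → key v ≟ key x) (x ∷ t))) (++-assoc q [ y ] rr))
        (count-prefix (λ v → key v ≟ key x) {x ∷ q ++ [ y ]} {rr}
          (refl ∷ All.tabulate λ {z} z∈ → case ∈-++⁻ q z∈ of λ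
            { (inj₁ zq) → ≤-antisym (≤-trans (All.lookup (low q y rr s) zq) (≤-reflexive (sym e))) (All.lookup a (∈-++⁺ˡ zq))
            ; (inj₂ (here refl)) → sym e }))

    -- Sort by key, take two consecutive blocks of `m + 1` vertices and alternate between them. The
    -- closing step joins the first vertex of the first block to the last of the second, at distance
    -- `2 * m + 1`.
    multipartite-cycle : (∀ {x y} → R x y → R y x) → ∀ m xs → Unique xs → 2 * suc m ≤ length xs → ClassesAtMost m xs →
      (∀ {x y} → x ∈ˡ xs → y ∈ˡ xs → key x ≢ key y → R x y) → Cycle R (2 * suc m)
    multipartite-cycle s m xs u le c r = go (sort xs) (sort-↭ xs)
        (Linked⇒AllPairs (λ {a b d} → ≤-trans {key a} {key b} {key d}) (sort-↗ xs))
      where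
      open Sort O using (sort; sort-↭; sort-↗)
      go : ∀ zs → zs ↭ xs → AllPairs Ord zs → Cycle R (2 * suc m)
      go zs p srt with split-at (suc m) zs (≤-trans (m≤m+n (suc m) _) (≤-trans le (≤-reflexive (sym (Perm.↭-length p)))))
      ... | a ∷ as , cs , refl , len with split-at (suc m) cs
        (+-cancelˡ-≤ (suc m) _ _ (≤-trans (≤-reflexive (cong (suc m +_) (sym (+-identityʳ (suc m)))))
          (≤-trans le (≤-reflexive (trans (sym (Perm.↭-length p)) (trans (cong suc (length-++ as)) (cong (_+ length cs) len)))))))
      ... | b ∷ bs , rest , refl , len′ = mkCycle a (b ∷ alternate as bs)
          (trans (Perm.↭-length perm) (trans (cong suc (length-++ as))
            (trans (cong₂ _+_ len len′) (cong (suc m +_) (sym (+-identityʳ (suc m)))))))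
          (Unique-↭ (↭-sym perm) (front (a ∷ as) (b ∷ bs) (Unique-↭ (↭-sym p) u)))
          (alternate-far s m a as [] b bs rest eq (trans (+-identityʳ _) (suc-injective len)) far
            (s (close (lst-split b bs))))
        where
        eq : length as ≡ length bs
        eq = suc-injective (trans len (sym len′))
        perm : alternate (a ∷ as) (b ∷ bs) ↭ a ∷ as ++ b ∷ bs
        perm = alternate-↭ (a ∷ as) (b ∷ bs) (cong suc eq)
        far : Far {R = R} m (a ∷ as ++ b ∷ bs ++ rest)
        far = sorted-far m _ srt (classes-↭ (↭-sym p) c) (λ x∈ y∈ → r (Perm.∈-resp-↭ p x∈) (Perm.∈-resp-↭ p y∈))
        close : ∃ (λ is → b ∷ bs ≡ is ++ [ lst b bs ] × length is ≡ length bs) → R a (lst b bs)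
        close (is , e , l) = proj₁ far (as ++ is) (lst b bs) rest
          (trans (cong (λ t → as ++ t ++ rest) e) (trans (cong (as ++_) (++-assoc is _ rest)) (sym (++-assoc as is _))))
          (≤-trans (≤-reflexive (sym (suc-injective len))) (≤-trans (m≤m+n _ _) (≤-trans (≤-reflexive (sym (length-++ as))) (n≤1+n _))))
        front : ∀ (us vs {ws} : List A) → Unique (us ++ vs ++ ws) → Unique (us ++ vs)
        front us vs {ws} uu = subst Unique (take-++ (us ++ vs) ws)
          (Uniq.take⁺ (length (us ++ vs)) (subst Unique (sym (++-assoc us vs ws)) uu))
          where
          take-++ : ∀ (us ws : List A) → take (length us) (us ++ ws) ≡ us
          take-++ [] ws = refl
          take-++ (x ∷ us) ws = cong (x ∷_) (take-++ us ws)

-- Greedy choice: fewer than K linking vertices are in use when the next one is picked.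
module _ (_≟ᴬ_ : DecidableEquality A) {R : A → A → Set} (R? : ∀ a b → Dec (R a b)) (X : List A) (uX : Unique X) where

  common : A → A → List A
  common y z = filter (λ x → R? y x ×-dec R? x z) X

  weave : ∀ K (Good : A → Set) → (∀ {y z} → Good y → Good z → y ≢ z → K ≤ length (common y z)) →
    ∀ used y ss z → All Good (z ∷ y ∷ ss) → Unique (z ∷ y ∷ ss) → length used + suc (length ss) ≤ K →
    ∃ λ zs → ∃ λ xs → Walk R y zs z × zs ↭ ss ++ xs × length xs ≡ suc (length ss) × Unique xs
      × (∀ {x} → x ∈ˡ xs → x ∈ˡ X × x ∉ used)
  weave K Good av used y [] z (gz ∷ gy ∷ []) ((z≢y ∷ []) ∷ _) le
    with pick _≟ᴬ_ (common y z) used (Uniq.filter⁺ _ uX)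
      (≤-trans (≤-trans (≤-reflexive (+-comm 1 _)) le) (av gy gz (z≢y ∘ sym)))
  ... | x , x∈ , x∉ with ∈-filter⁻ (λ x → R? y x ×-dec R? x z) x∈
  ... | x∈X , r , r′ = [ x ] , [ x ] , (r , r′) , ↭-refl , refl , [] ∷ [] , λ { (here refl) → x∈X , x∉ }
  weave K Good av used y (s ∷ ss) z (gz ∷ gy ∷ gs ∷ gss) ((z≢y ∷ z≢s ∷ z∉) ∷ (y≢s ∷ _) ∷ u) le
    with pick _≟ᴬ_ (common y s) used (Uniq.filter⁺ _ uX)
      (≤-trans (≤-trans (≤-reflexive (+-comm 1 _)) (≤-trans (+-monoʳ-≤ (length used) (s≤s z≤n)) le)) (av gy gs y≢s))
  ... | x , x∈ , x∉ with ∈-filter⁻ (λ x → R? y x ×-dec R? x s) x∈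
    | weave K Good av (x ∷ used) s ss z (gz ∷ gs ∷ gss) ((z≢s ∷ z∉) ∷ u) (≤-trans (≤-reflexive (sym (+-suc _ _))) le)
  ... | x∈X , r , r′ | zs , xs , w , p , len , ux , h =
    x ∷ s ∷ zs , x ∷ xs , (r , r′ , w)
    , ↭-trans (swap x s p) (prep s (↭-sym (Perm.shift x ss xs)))
    , cong suc len , Unique-∷ (λ q → proj₂ (h q) (here refl)) ux
    , λ { (here refl) → x∈X , x∉ ; (there q) → proj₁ (h q) , proj₂ (h q) ∘ there }

-- Lengthening a monochromatic cycle by two

-- A two-coloured complete multipartite graph: vertices with the same label are
-- non-adjacent twins.
record TwinColouring (M : ℕ) : Set₁ where
  field
    E : Bool → Fin M → Fin M → Set
    E? : ∀ b x y → Dec (E b x y)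
    label : Fin M → ℕ
    E-sym : ∀ {b x y} → E b x y → E b y x
    E-or : ∀ {x y} → label x ≢ label y → E true x y ⊎ E false x y
    E-twin : ∀ {b x y z} → label x ≡ label y → E b x z → E b y z
    E-irr : ∀ {b x y} → E b x y → label x ≢ label y

  E-either : ∀ b {x y} → label x ≢ label y → E b x y ⊎ E (not b) x y
  E-either true ne = E-or ne
  E-either false ne with E-or ne
  ... | inj₁ e = inj₂ e
  ... | inj₂ e = inj₁ e

  E-≢ : ∀ {b x y} → E b x y → x ≢ y
  E-≢ e refl = E-irr e refl

  MonoCyc : ℕ → Set
  MonoCyc k = ∃ λ b → Cycle (E b) k

-- Constructive case distinction: a vertex without `P` already supplies the goal `G`, so `P` may be
-- assumed everywhere.
all-or : ∀ {M} {P : Fin M → Set} {G : Set} → (∀ x → P x ⊎ G) → (∀ x → P x) ⊎ G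
all-or {zero} f = inj₁ λ ()
all-or {suc M} f with f zero | all-or (f ∘ suc)
... | inj₂ g | _ = inj₂ g
... | inj₁ _ | inj₂ g = inj₂ g
... | inj₁ p | inj₁ q = inj₁ λ { zero → p ; (suc x) → q x }

-- Counting the steps of a closed walk by properties of their ends.

module _ {P Q S : A → A → Set} (P? : ∀ a b → Dec (P a b)) (Q? : ∀ a b → Dec (Q a b)) (S? : ∀ a b → Dec (S a b))
  (sub : ∀ {a b} → P a b → Q a b ⊎ S a b) where

  private
    one : ∀ x y → length (filter (λ w → P? w y) [ x ]) ≤ length (filter (λ w → Q? w y) [ x ]) + length (filter (λ w → S? w y) [ x ])
    one x y with P? x y | Q? x y | S? x y
    ... | no _ | _ | _ = z≤n
    ... | yes _ | yes _ | _ = s≤s z≤n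
    ... | yes _ | no _ | yes _ = s≤s z≤n
    ... | yes p | no ¬q | no ¬s = ⊥-elim ([ ¬q , ¬s ]′ (sub p))

  edges-⊎ : ∀ x ys z → edges P? x ys z ≤ edges Q? x ys z + edges S? x ys z
  edges-⊎ x [] z = one x z
  edges-⊎ x (y ∷ ys) z = ≤-trans (+-mono-≤ (one x y) (edges-⊎ y ys z))
    (≤-reflexive (lem (# Q? x y) (# S? x y) (edges Q? y ys z) (edges S? y ys z)))
    where
    # : ∀ {T : A → A → Set} → (∀ a b → Dec (T a b)) → A → A → ℕ
    # T? x y = length (filter (λ w → T? w y) [ x ])
    lem : ∀ a b c d → (a + b) + (c + d) ≡ (a + c) + (b + d)
    lem = solve-∀

module _ {V : A → Set} (V? : U.Decidable V) where

  count-cons : ∀ a xs → length (filter V? (a ∷ xs)) ≡ length (filter V? [ a ]) + length (filter V? xs)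
  count-cons a xs with V? a
  ... | yes _ = refl
  ... | no _ = refl

  count-snoc : ∀ xs a → length (filter V? (xs ∷ʳ a)) ≡ length (filter V? (a ∷ xs))
  count-snoc xs a = Perm.↭-length (Perm.filter-↭ V? (↭-sym (Perm.∷↭∷ʳ a xs)))

  both? : ∀ a b → Dec (V a × V b)
  both? a b = V? a ×-dec V? b

  -- For a step from `a` to `b`, the number of its ends in `V` is at most one, plus one if both are
  -- in `V`. This is summed over all steps.
  count-edges : ∀ x ys z → length (filter V? (x ∷ ys)) + length (filter V? (ys ∷ʳ z)) ≤ suc (length ys) + edges both? x ys z
  count-edges x [] z with V? x | V? z
  ... | yes _ | yes _ = ≤-refl
  ... | yes _ | no _ = ≤-refl
  ... | no _ | yes _ = ≤-refl
  ... | no _ | no _ = z≤n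
  count-edges x (y ∷ ys) z = begin
    cx + length (filter V? (y ∷ (ys ∷ʳ z))) ≡⟨ cong₂ _+_ (count-cons x (y ∷ ys)) (count-cons y (ys ∷ʳ z)) ⟩
    (# x + l₁) + (# y + l₂) ≡⟨ lem (# x) l₁ (# y) l₂ ⟩
    (# x + # y) + (l₁ + l₂) ≤⟨ +-mono-≤ (one x y) (count-edges y ys z) ⟩
    (1 + e) + (suc (length ys) + edges both? y ys z) ≡⟨ lem (1) e (suc (length ys)) _ ⟩
    suc (suc (length ys)) + (e + edges both? y ys z) ∎
    where
    open ≤-Reasoning
    # : A → ℕ
    # a = length (filter V? [ a ])
    cx = length (filter V? (x ∷ y ∷ ys))
    l₁ = length (filter V? (y ∷ ys))
    l₂ = length (filter V? (ys ∷ʳ z))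
    e = length (filter (λ w → both? w y) [ x ])
    lem : ∀ a b c d → (a + b) + (c + d) ≡ (a + c) + (b + d)
    lem = solve-∀
    one : ∀ x y → # x + # y ≤ 1 + length (filter (λ w → both? w y) [ x ])
    one x y with V? x | V? y
    ... | yes _ | yes _ = ≤-refl
    ... | yes _ | no _ = ≤-refl
    ... | no _ | yes _ = ≤-refl
    ... | no _ | no _ = z≤n

  -- In a closed walk each listed vertex starts one step and ends another.
  count-cycle : ∀ x ys → 2 * length (filter V? (x ∷ ys)) ≤ suc (length ys) + edges both? x ys x
  count-cycle x ys = ≤-trans (≤-reflexive (trans (cong (l +_) (+-identityʳ l)) (cong (l +_) (sym (count-snoc ys x))))) (count-edges x ys x)
    where l = length (filter V? (x ∷ ys))

module _ {P : A → A → Set} (P? : ∀ a b → Dec (P a b)) where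

  one-edge : ∀ x ys → 1 ≤ edges P? x ys x →
    ∃ λ d → ∃ λ bs → (d ∷ bs) ↭ (x ∷ ys) × (∀ {R : A → A → Set} → Walk R x ys x → Walk R d bs d) × P (lst d bs) d
  one-edge x ys h with edges-one P? x ys x h
  ... | inj₂ p = x , ys , ↭-refl , id , p
  ... | inj₁ (as , d , bs , refl , p) = d , bs ++ x ∷ as , Perm.++-comm (d ∷ bs) (x ∷ as)
    , (λ w → let (u , v) = walk-split x as d bs w in walk-++ d bs x as v u)
    , subst (λ t → P t d) (sym (lst-++ d bs x as)) p

rotate-to : ∀ {R : A → A → Set} x ys {v} → v ∈ˡ x ∷ ys → Walk R x ys x → ∃ λ zs → (v ∷ zs) ↭ (x ∷ ys) × Walk R v zs v
rotate-to x ys (here refl) w = ys , ↭-refl , w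
rotate-to x ys (there v∈) w with ∈-∃++ v∈
... | as , bs , refl = bs ++ x ∷ as , Perm.++-comm (_ ∷ bs) (x ∷ as) ,
  (let (u , v) = walk-split x as _ bs w in walk-++ _ bs x as v u)

-- Inserting two vertices into a monochromatic cycle.

module Surgery {M : ℕ} (T : TwinColouring M) (b : Bool) (m : ℕ) (C : Cycle (TwinColouring.E T b) (2 * m)) where
  open TwinColouring T
  open Cycle C public renaming (hd to c₀; tl to cs; len to lenC; unique to uC; walk to wC)

  on : List (Fin M)
  on = c₀ ∷ cs

  R : Fin M → Fin M → Set
  R = E b

  private
    dbl : 2 * suc m ≡ suc (suc (2 * m))
    dbl = lem m where
      lem : ∀ m → 2 * suc m ≡ suc (suc (2 * m))
      lem = solve-∀

    grown : ∀ {y y′ z zs} → y ≢ y′ → y ∉ on → y′ ∉ on → (z ∷ zs) ↭ (y ∷ y′ ∷ on) → Walk R z zs z → MonoCyc (2 * suc m)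
    grown ne y∉ y′∉ p w = b , mkCycle _ _
      (trans (Perm.↭-length p) (trans (cong (λ t → suc (suc t)) lenC) (sym dbl)))
      (Unique-↭ (↭-sym p) (Unique-∷ (λ { (here e) → ne e ; (there q) → y∉ q }) (Unique-∷ y′∉ uC))) w

  -- Meant for a step from `a` to `d` of the cycle. With `y` and `y′` equal it says that the vertex
  -- can be inserted between `a` and `d`.
  cross : Fin M → Fin M → Fin M → Fin M → Set
  cross y y′ a d = R y a × R y′ d

  cross? : ∀ y y′ a d → Dec (cross y y′ a d)
  cross? y y′ a d = E? b y a ×-dec E? b y′ d

  -- Both steps are deleted and one arc is reversed: from `y` to `lst d as`, backwards to `d`, then
  -- `y′`, then `h′` and forwards along the other arc, whose last vertex is adjacent to `y`.
  insert-crossing : ∀ {y y′} → y ≢ y′ → y ∉ on → y′ ∉ on → 2 ≤ edges (cross? y y′) c₀ cs c₀ → MonoCyc (2 * suc m)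
  insert-crossing {y} {y′} ne y∉ y′∉ h with two-edges (cross? y y′) c₀ cs h
  ... | d , as , h′ , bs , rot , (ra , rd) , (ra′ , rh) with Rotation.walks rot wC
  ... | w₁ , w₂ = grown ne y∉ y′∉
    (prep y (↭-trans (Perm.shift y′ (reverse (d ∷ as)) (h′ ∷ bs))
      (prep y′ (↭-trans (Perm.++⁺ʳ (h′ ∷ bs) (Perm.↭-reverse (d ∷ as))) (Rotation.perm rot)))))
    (walk-++ y (reverse (d ∷ as)) y′ (h′ ∷ bs)
      (walk-rev E-sym y′ (d ∷ as) (rd , walk-end d as w₁ (E-sym ra′)))
      (rh , walk-end h′ bs w₂ (E-sym ra)))

  insert-two : ∀ {y y′} → y ≢ y′ → y ∉ on → y′ ∉ on → ∀ {d as h bs} → Rotation c₀ cs d as h bs →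
    cross y y (lst h bs) d → cross y′ y′ (lst d as) h → MonoCyc (2 * suc m)
  insert-two {y} {y′} ne y∉ y′∉ {d} {as} {h} {bs} rot (ra , rd) (ra′ , rh) with Rotation.walks rot wC
  ... | w₁ , w₂ = grown ne y∉ y′∉
    (prep y (↭-trans (Perm.shift y′ (d ∷ as) (h ∷ bs)) (prep y′ (Rotation.perm rot))))
    (rd , walk-++ d as y′ (h ∷ bs) (walk-end d as w₁ (E-sym ra′)) (rh , walk-end h bs w₂ (E-sym ra)))

  -- The path `a`, `y`, `y′`, `d` replaces the step from `a` to `d`.
  insert-edge : ∀ {y y′} → R y y′ → y ∉ on → y′ ∉ on → 1 ≤ edges (cross? y y′) c₀ cs c₀ → MonoCyc (2 * suc m)
  insert-edge {y} {y′} r y∉ y′∉ h with one-edge (cross? y y′) c₀ cs h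
  ... | d , bs , p , wk , (ra , rd) = grown (E-≢ r) y∉ y′∉ (prep y (prep y′ p)) (r , rd , walk-end d bs (wk wC) (E-sym ra))

  -- The step into `x` can enter its twin `y` instead, and `r` is adjacent to both twins, so the
  -- path `y`, `r`, `x` takes the place of `x`.
  insert-twin : ∀ {x y r} → x ∈ˡ on → label x ≡ label y → R y r → y ∉ on → r ∉ on → MonoCyc (2 * suc m)
  insert-twin {x} {y} {r} x∈ tw e y∉ r∉ with rotate-to c₀ cs x∈ wC
  ... | zs , p , w = grown (E-≢ e) y∉ r∉ (prep y (prep r p))
    (e , E-sym (E-twin (sym tw) e) , walk-end x zs w (E-sym (E-twin tw (E-sym (walk-last x zs w)))))

  doubled : Fin M → Fin M → Fin M → Fin M → Set
  doubled y y′ a d = cross y y a d ⊎ cross y′ y′ a d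

  doubled? : ∀ y y′ a d → Dec (doubled y y′ a d)
  doubled? y y′ a d = cross? y y a d ⊎-dec cross? y′ y′ a d

  Heavy : Fin M → Set
  Heavy y = 2 ≤ edges (cross? y y) c₀ cs c₀

  private
    heavy : ∀ {y d as h bs} → Rotation c₀ cs d as h bs → cross y y (lst h bs) d → cross y y (lst d as) h → Heavy y
    heavy {y} {d} {as} {h} {bs} rot q q′ = ≤-trans (+-mono-≤ (edges-last (cross? y y) d as h q′) (edges-last (cross? y y) h bs d q))
      (≤-reflexive (sym (Rotation.edges-≡ rot (cross? y y))))

  -- If the two steps found belong to different vertices, both vertices are inserted; otherwise one
  -- vertex owns both steps and is heavy.
  insert-doubled : ∀ {y y′} → y ≢ y′ → y ∉ on → y′ ∉ on → 2 ≤ edges (doubled? y y′) c₀ cs c₀ →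
    MonoCyc (2 * suc m) ⊎ Heavy y ⊎ Heavy y′
  insert-doubled {y} {y′} ne y∉ y′∉ h with two-edges (doubled? y y′) c₀ cs h
  ... | d , as , h′ , bs , rot , inj₁ q , inj₂ q′ = inj₁ (insert-two ne y∉ y′∉ rot q q′)
  ... | d , as , h′ , bs , rot , inj₂ q , inj₁ q′ = inj₁ (insert-two (ne ∘ sym) y′∉ y∉ rot q q′)
  ... | d , as , h′ , bs , rot , inj₁ q , inj₁ q′ = inj₂ (inj₁ (heavy rot q q′))
  ... | d , as , h′ , bs , rot , inj₂ q , inj₂ q′ = inj₂ (inj₂ (heavy rot q q′))

  private
    side : ∀ {y y′} → y ≢ y′ → y ∉ on → y′ ∉ on → ∀ {d as h bs} → Rotation c₀ cs d as h bs →
      cross y y (lst h bs) d → 1 ≤ edges (cross? y′ y′) d as h → MonoCyc (2 * suc m)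
    side {y} {y′} ne y∉ y′∉ {d} {as} {h} {bs} rot q e with edges-one (cross? y′ y′) d as h e
    ... | inj₂ p = insert-two ne y∉ y′∉ rot q p
    ... | inj₁ (as₁ , g , as₂ , refl , p) = insert-two ne y∉ y′∉ (rotation-shift {as = as₁} {cs = as₂} rot)
      (subst (λ t → cross y y t d) (sym (lst-++ g as₂ h bs)) q) p

  -- Two steps available to `y` end the two arcs of the cycle. Whichever arc holds a step for `y′`,
  -- the vertex `y` goes into the last step of the other arc.
  heavy-unique : ∀ {y y′} → y ≢ y′ → y ∉ on → y′ ∉ on → Heavy y → 1 ≤ edges (cross? y′ y′) c₀ cs c₀ → MonoCyc (2 * suc m)
  heavy-unique {y} {y′} ne y∉ y′∉ hv h with two-edges (cross? y y) c₀ cs hv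
  ... | d , as , h′ , bs , rot , q , q′ with 1 ≤? edges (cross? y′ y′) d as h′ | 1 ≤? edges (cross? y′ y′) h′ bs d
  ... | yes e | _ = side ne y∉ y′∉ rot q e
  ... | no _ | yes e = side ne y∉ y′∉ (rotation-swap rot) q′ e
  ... | no ¬e | no ¬e′ = ⊥-elim (lem h (Rotation.edges-≡ rot (cross? y′ y′)) ¬e ¬e′)
    where
    lem : ∀ {a b c} → 1 ≤ a → a ≡ b + c → ¬ 1 ≤ b → ¬ 1 ≤ c → ⊥
    lem {b = suc _} _ _ ¬b _ = ¬b (s≤s z≤n)
    lem {b = zero} {suc _} _ _ _ ¬c = ¬c (s≤s z≤n)
    lem {b = zero} {zero} (s≤s _) () _ _

bip : ∀ {A : Set} {R : A → A → Set} → (∀ {x y} → R x y → R y x) → (∀ {x y} → R x y → x ≢ y) → ∀ k as bs →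
  suc k ≤ length as → suc k ≤ length bs → Unique as → Unique bs → (∀ {x y} → x ∈ˡ as → y ∈ˡ bs → R x y) → Cycle R (2 * suc k)
bip {A} {R} s ne k as bs ka kb ua ub c with split-at (suc k) as ka | split-at (suc k) bs kb
... | a ∷ as₁ , as₂ , refl , la | b ∷ bs₁ , bs₂ , refl , lb = subst (λ t → Cycle R (2 * t)) la
  (bipartite-cycle s a as₁ b bs₁ (suc-injective (trans la (sym lb))) (λ p q → c (∈-++⁺ˡ p) (∈-++⁺ˡ q))
    (Unique-++ (front (a ∷ as₁) ua) (front (b ∷ bs₁) ub) (λ p q → ne (c (∈-++⁺ˡ p) (∈-++⁺ˡ q)) refl)))
  where
  front : ∀ (us : List A) {ws} → Unique (us ++ ws) → Unique us
  front [] _ = []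
  front (x ∷ us) (p ∷ u) = All.tabulate (λ z∈ → All.lookup p (∈-++⁺ˡ z∈)) ∷ front us u

filter-mono : ∀ {A : Set} {P Q : A → Set} (P? : U.Decidable P) (Q? : U.Decidable Q) xs ys → Unique xs →
  (∀ {x} → x ∈ˡ xs → P x → x ∈ˡ ys × Q x) → length (filter P? xs) ≤ length (filter Q? ys)
filter-mono P? Q? xs ys u f = unique-⊆-length (Uniq.filter⁺ P? u) λ z∈ →
  let (z∈xs , pz) = ∈-filter⁻ P? z∈ ; (z∈ys , qz) = f z∈xs pz in ∈-filter⁺ Q? z∈ys qz

module _ {M : ℕ} where
  open import Data.List.Membership.DecPropositional (Fin._≟_ {M}) using (_∈?_) public

-- Large twin classes give the cycle at once.

module Large {M : ℕ} (T : TwinColouring M) (n : ℕ) (4n≤M : 4 * n ≤ M)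
  (small : ClassesAtMost (TwinColouring.label T) n (allFin M)) where
  open TwinColouring T

  private
    all = allFin M
    lenAll : length all ≡ M
    lenAll = length-tabulate id

  -- One of the two colours joins v, hence its whole class, to m + 1 of the vertices outside.
  class-cycle : ∀ m v → m < n → m < length (filter (λ w → label w ≟ label v) all) → MonoCyc (2 * suc m)
  class-cycle m v m<n big = go (suc m ≤? length reds)
    where
    class = filter (λ w → label w ≟ label v) all
    rest = filter (λ w → ¬? (label w ≟ label v)) all
    reds = filter (E? true v) rest
    blues = filter (¬? ∘ E? true v) rest
    uRest = Uniq.filter⁺ (λ w → ¬? (label w ≟ label v)) (Uniq.allFin⁺ M)
    uClass = Uniq.filter⁺ (λ w → label w ≟ label v) (Uniq.allFin⁺ M)
    restBig : suc m + suc m ≤ length rest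
    restBig = +-cancelˡ-≤ (length class) _ _ (begin
      length class + (suc m + suc m) ≤⟨ +-mono-≤ (small (label v)) (+-mono-≤ m<n m<n) ⟩
      n + (n + n) ≤⟨ m≤m+n _ n ⟩
      n + (n + n) + n ≡⟨ lem n ⟩
      4 * n ≤⟨ 4n≤M ⟩
      M ≡⟨ sym (trans (filter-++¬ (λ w → label w ≟ label v) all) lenAll) ⟩
      length class + length rest ∎)
      where
      open ≤-Reasoning
      lem : ∀ n → n + (n + n) + n ≡ 4 * n
      lem = solve-∀
    mono : ∀ b (ws : List (Fin M)) → suc m ≤ length ws → Unique ws → (∀ {w} → w ∈ˡ ws → E b v w) → MonoCyc (2 * suc m)
    mono b ws le u f = b , bip E-sym E-≢ m class ws big le uClass u
      (λ x∈ y∈ → E-twin (sym (proj₂ (∈-filter⁻ (λ w → label w ≟ label v) {xs = all} x∈))) (f y∈))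
    go : Dec (suc m ≤ length reds) → MonoCyc (2 * suc m)
    go (yes le) = mono true reds le (Uniq.filter⁺ (E? true v) uRest) (filter-holds (E? true v) {rest})
    go (no ¬le) = mono false blues le (Uniq.filter⁺ (¬? ∘ E? true v) uRest) λ w∈ →
        let (w∈rest , ¬e) = ∈-filter⁻ (¬? ∘ E? true v) {xs = rest} w∈
            ne = proj₂ (∈-filter⁻ (λ w → ¬? (label w ≟ label v)) {xs = all} w∈rest)
        in [ (λ e → ⊥-elim (¬e e)) , id ]′ (E-or (ne ∘ sym))
      where
      le : suc m ≤ length blues
      le = +-cancelˡ-≤ (suc m) _ _ (≤-trans restBig (≤-trans (≤-reflexive (sym (filter-++¬ (E? true v) rest)))
        (+-monoˡ-≤ _ (≤-trans (n≤1+n _) (≰⇒> ¬le)))))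

  small-classes : ∀ m → m < n → ClassesAtMost label m all ⊎ MonoCyc (2 * suc m)
  small-classes m m<n with all-or (λ v → bound v (length (filter (λ w → label w ≟ label v) all) ≤? m))
    where
    bound : ∀ v → Dec _ → length (filter (λ w → label w ≟ label v) all) ≤ m ⊎ MonoCyc (2 * suc m)
    bound v (yes le) = inj₁ le
    bound v (no ¬le) = inj₂ (class-cycle m v m<n (≰⇒> ¬le))
  ... | inj₂ g = inj₂ g
  ... | inj₁ f = inj₁ h
    where
    h : ClassesAtMost label m all
    h k with filter (λ w → label w ≟ k) all in eq
    ... | [] = z≤n
    ... | v ∷ vs with proj₂ (∈-filter⁻ (λ w → label w ≟ k) {xs = all} (subst (v ∈ˡ_) (sym eq) (here refl)))
    ... | refl = subst (λ t → length t ≤ m) eq (f v)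

edges-none : ∀ {A : Set} {P : A → A → Set} (P? : ∀ a b → Dec (P a b)) → (∀ {a b} → ¬ P a b) → ∀ x ys z → edges P? x ys z ≡ 0
edges-none P? ¬p x [] z with P? x z
... | yes p = ⊥-elim (¬p p)
... | no _ = refl
edges-none P? ¬p x (y ∷ ys) z with P? x y
... | yes p = ⊥-elim (¬p p)
... | no _ = edges-none P? ¬p y ys z

edges-mono : ∀ {A : Set} {P Q : A → A → Set} (P? : ∀ a b → Dec (P a b)) (Q? : ∀ a b → Dec (Q a b)) →
  (∀ {a b} → P a b → Q a b) → ∀ x ys z → edges P? x ys z ≤ edges Q? x ys z
edges-mono P? Q? f x ys z = ≤-trans (edges-⊎ P? Q? (λ _ _ → no id) (inj₁ ∘ f) x ys z)
  (≤-reflexive (trans (cong (edges Q? x ys z +_) (edges-none (λ _ _ → no id) id x ys z)) (+-identityʳ _)))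

-- Cycles that admit no insertion.

module Stuck {M : ℕ} (T : TwinColouring M) (b : Bool) (m : ℕ) (C : Cycle (TwinColouring.E T b) (2 * m)) where
  open TwinColouring T
  open Surgery T b m C public

  B : Fin M → Fin M → Set
  B = E (not b)

  B? : ∀ x y → Dec (B x y)
  B? = E? (not b)

  Mixed : Fin M → Set
  Mixed y = Any (λ x → label x ≡ label y) on

  Mixed? : U.Decidable Mixed
  Mixed? y = any? (λ x → label x ≟ label y) on

  Heavy? : U.Decidable Heavy
  Heavy? y = 2 ≤? edges (cross? y y) c₀ cs c₀

  -- The applicable insertions form one decidable relation, so that its failure can be assumed for
  -- all pairs at once. Lightness in the last case excludes the heavy outcomes of `insert-doubled`.
  Growable : Fin M → Fin M → Set
  Growable y y′ = y ∉ on × y′ ∉ on ×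
    (  (R y y′ × Mixed y)
    ⊎ (R y y′ × 1 ≤ edges (cross? y y′) c₀ cs c₀)
    ⊎ (y ≢ y′ × 2 ≤ edges (cross? y y′) c₀ cs c₀)
    ⊎ (y ≢ y′ × Heavy y × 1 ≤ edges (cross? y′ y′) c₀ cs c₀)
    ⊎ (y ≢ y′ × 2 ≤ edges (doubled? y y′) c₀ cs c₀ × ¬ Heavy y × ¬ Heavy y′))

  Growable? : ∀ y y′ → Dec (Growable y y′)
  Growable? y y′ = ¬? (y ∈? on) ×-dec ¬? (y′ ∈? on) ×-dec
    (  (E? b y y′ ×-dec Mixed? y)
    ⊎-dec (E? b y y′ ×-dec (1 ≤? edges (cross? y y′) c₀ cs c₀))
    ⊎-dec (¬? (y Fin.≟ y′) ×-dec (2 ≤? edges (cross? y y′) c₀ cs c₀))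
    ⊎-dec (¬? (y Fin.≟ y′) ×-dec Heavy? y ×-dec (1 ≤? edges (cross? y′ y′) c₀ cs c₀))
    ⊎-dec (¬? (y Fin.≟ y′) ×-dec (2 ≤? edges (doubled? y y′) c₀ cs c₀) ×-dec ¬? (Heavy? y) ×-dec ¬? (Heavy? y′)))

  grow : ∀ {y y′} → Growable y y′ → MonoCyc (2 * suc m)
  grow (y∉ , y′∉ , inj₁ (r , mx)) = let (x , x∈ , e) = find mx in insert-twin x∈ e r y∉ y′∉
  grow (y∉ , y′∉ , inj₂ (inj₁ (r , h))) = insert-edge r y∉ y′∉ h
  grow (y∉ , y′∉ , inj₂ (inj₂ (inj₁ (ne , h)))) = insert-crossing ne y∉ y′∉ h
  grow (y∉ , y′∉ , inj₂ (inj₂ (inj₂ (inj₁ (ne , hv , h))))) = heavy-unique ne y∉ y′∉ hv h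
  grow (y∉ , y′∉ , inj₂ (inj₂ (inj₂ (inj₂ (ne , h , l , l′))))) with insert-doubled ne y∉ y′∉ h
  ... | inj₁ g = g
  ... | inj₂ (inj₁ hv) = ⊥-elim (l hv)
  ... | inj₂ (inj₂ hv) = ⊥-elim (l′ hv)

  stuck-or : (∀ y y′ → ¬ Growable y y′) ⊎ MonoCyc (2 * suc m)
  stuck-or = all-or λ y → all-or λ y′ → decide (Growable? y y′)
    where
    decide : ∀ {y y′} → Dec (Growable y y′) → ¬ Growable y y′ ⊎ MonoCyc (2 * suc m)
    decide (yes g) = inj₂ (grow g)
    decide (no ¬g) = inj₁ ¬g

  module _ (stuck : ∀ y y′ → ¬ Growable y y′) where

    record Plain (y : Fin M) : Set where
      constructor plain
      field
        off : y ∉ on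
        unmixed : ¬ Mixed y
        light : ¬ Heavy y

    private
      seen? : ∀ y y′ → U.Decidable (λ v → R y v ⊎ R y′ v)
      seen? y y′ v = E? b y v ⊎-dec E? b y′ v

      seen : Fin M → Fin M → ℕ
      seen y y′ = length (filter (seen? y y′) on)

      -- A plain vertex has no twin on the cycle, so it is joined in blue to every cycle vertex that
      -- is not a red neighbour.
      unseen : ∀ {y y′} → Plain y → Plain y′ → 2 * m ≤ seen y y′ + length (common Fin._≟_ B? on uC y y′)
      unseen {y} {y′} p p′ = ≤-trans (≤-reflexive (trans (sym lenC) (sym (filter-++¬ (seen? y y′) on))))
        (+-monoʳ-≤ (seen y y′) (filter-mono (¬? ∘ seen? y y′) (λ x → B? y x ×-dec B? x y′) on on uC
          λ x∈ ¬s → x∈ , blue p x∈ (¬s ∘ inj₁) , E-sym (blue p′ x∈ (¬s ∘ inj₂))))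
        where
        blue : ∀ {y x} → Plain y → x ∈ˡ on → ¬ R y x → B y x
        blue {y} {x} p x∈ ¬r = [ ⊥-elim ∘ ¬r , id ]′ (E-either b λ e → Plain.unmixed p (lose x∈ (sym e)))

      pairs : ∀ y y′ → 2 * seen y y′ ≤ 2 * m + edges (both? (seen? y y′)) c₀ cs c₀
      pairs y y′ = subst (λ t → 2 * seen y y′ ≤ t + edges (both? (seen? y y′)) c₀ cs c₀) lenC (count-cycle (seen? y y′) c₀ cs)

      few-doubled : ∀ {y y′} → Plain y → Plain y′ → y ≢ y′ → edges (doubled? y y′) c₀ cs c₀ ≤ 1
      few-doubled {y} {y′} (plain o _ l) (plain o′ _ l′) ne =
        ≤-pred (≰⇒> λ h → stuck y y′ (o , o′ , inj₂ (inj₂ (inj₂ (inj₂ (ne , h , l , l′))))))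

      split : ∀ y y′ → edges (both? (seen? y y′)) c₀ cs c₀ ≤
        edges (cross? y y′) c₀ cs c₀ + (edges (cross? y′ y) c₀ cs c₀ + edges (doubled? y y′) c₀ cs c₀)
      split y y′ = ≤-trans (edges-⊎ (both? (seen? y y′)) (cross? y y′) (λ a d → cross? y′ y a d ⊎-dec doubled? y y′ a d)
          (λ { (inj₁ p , inj₂ q) → inj₁ (p , q) ; (inj₂ p , inj₁ q) → inj₂ (inj₁ (p , q))
             ; (inj₁ p , inj₁ q) → inj₂ (inj₂ (inj₁ (p , q))) ; (inj₂ p , inj₂ q) → inj₂ (inj₂ (inj₂ (p , q))) }) c₀ cs c₀)
        (+-monoʳ-≤ _ (edges-⊎ _ (cross? y′ y) (doubled? y y′) id c₀ cs c₀))

      half : ∀ s c t → 2 * s ≤ 2 * m + c → c < 2 * suc t → s ≤ m + t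
      half s c t h c< = ≮⇒≥ λ lt → <⇒≱ (begin-strict
        2 * m + c <⟨ +-monoʳ-< (2 * m) c< ⟩
        2 * m + 2 * suc t ≡⟨ lem m t ⟩
        2 * suc (m + t) ≤⟨ *-monoʳ-≤ 2 lt ⟩
        2 * s ∎) h
        where
        open ≤-Reasoning
        lem : ∀ m t → 2 * m + 2 * suc t ≡ 2 * suc (m + t)
        lem = solve-∀

    -- At most three edges of the cycle have both ends seen by y or y′ (one for each crossing
    -- and one doubled edge), so at most m + 1 of the 2 m vertices are seen.
    link : ∀ {y y′} → Plain y → Plain y′ → y ≢ y′ → m ≤ suc (length (common Fin._≟_ B? on uC y y′))
    link {y} {y′} p p′ ne = +-cancelˡ-≤ m _ _ (begin
      m + m ≡⟨ cong (m +_) (sym (+-identityʳ m)) ⟩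
      2 * m ≤⟨ unseen p p′ ⟩
      seen y y′ + l ≤⟨ +-monoˡ-≤ l (half (seen y y′) 3 1 (≤-trans (pairs y y′) (+-monoʳ-≤ (2 * m) (≤-trans (split y y′)
         (+-mono-≤ (few y y′ p p′ ne) (+-mono-≤ (few y′ y p′ p (ne ∘ sym)) (few-doubled p p′ ne)))))) ≤-refl) ⟩
      m + 1 + l ≡⟨ +-assoc m 1 l ⟩
      m + suc l ∎)
      where
      open ≤-Reasoning
      l = length (common Fin._≟_ B? on uC y y′)
      few : ∀ y y′ → Plain y → Plain y′ → y ≢ y′ → edges (cross? y y′) c₀ cs c₀ ≤ 1
      few y y′ p p′ ne = ≤-pred (≰⇒> λ h → stuck y y′ (Plain.off p , Plain.off p′ , inj₂ (inj₂ (inj₁ (ne , h)))))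

    -- Twins see the same vertices, so a step with both ends seen is doubled; if `y` and `y′` are
    -- joined in red, no step is crossing. Either way at most one step has both ends seen, so at
    -- most `m` vertices are seen.
    link-nonblue : ∀ {y y′} → Plain y → Plain y′ → y ≢ y′ → ¬ B y y′ → m ≤ length (common Fin._≟_ B? on uC y y′)
    link-nonblue {y} {y′} p p′ ne ¬bl = +-cancelˡ-≤ m _ _ (begin
      m + m ≡⟨ cong (m +_) (sym (+-identityʳ m)) ⟩
      2 * m ≤⟨ unseen p p′ ⟩
      seen y y′ + l ≤⟨ +-monoˡ-≤ l (half (seen y y′) 1 0 (≤-trans (pairs y y′) (+-monoʳ-≤ (2 * m) one)) ≤-refl) ⟩
      m + 0 + l ≡⟨ cong (_+ l) (+-identityʳ m) ⟩
      m + l ∎)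
      where
      open ≤-Reasoning
      l = length (common Fin._≟_ B? on uC y y′)
      one : edges (both? (seen? y y′)) c₀ cs c₀ ≤ 1
      one with label y ≟ label y′
      ... | yes e = ≤-trans (edges-mono (both? (seen? y y′)) (doubled? y y′)
              (λ (p , q) → inj₁ ([ id , E-twin (sym e) ]′ p , [ id , E-twin (sym e) ]′ q)) c₀ cs c₀)
            (few-doubled p p′ ne)
      ... | no e = ≤-trans (split y y′) (+-mono-≤ (none y y′ p p′ r) (+-mono-≤ (none y′ y p′ p (E-sym r)) (few-doubled p p′ ne)))
        where
        r : R y y′
        r = [ id , ⊥-elim ∘ ¬bl ]′ (E-either b e)
        none : ∀ y y′ → Plain y → Plain y′ → R y y′ → edges (cross? y y′) c₀ cs c₀ ≤ 0
        none y y′ p p′ r = ≤-pred (≰⇒> λ h → stuck y y′ (Plain.off p , Plain.off p′ , inj₂ (inj₁ (r , h))))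

-- Blue cycles woven between a stuck red cycle and the vertices off it.

module Weaving {M : ℕ} (T : TwinColouring M) (b : Bool) (k : ℕ) (C : Cycle (TwinColouring.E T b) (2 * suc (suc k)))
  (stuck : ∀ y y′ → ¬ Stuck.Growable T b (suc (suc k)) C y y′) (Ys : List (Fin M)) (uY : Unique Ys)
  (plainY : ∀ {y} → y ∈ˡ Ys → Stuck.Plain T b (suc (suc k)) C stuck y) (big : 5 + k ≤ length Ys) where
  open TwinColouring T
  open Stuck T b (suc (suc k)) C

  private
    Goal : Set
    Goal = MonoCyc (2 * suc (suc (suc k)))

    offY : ∀ {y} → y ∈ˡ Ys → y ∉ on
    offY = Plain.off ∘ plainY

    -- `F` stands for the vertices of a short blue path between `v` and `w`. The woven walk closes
    -- that path through `k` further vertices of `Ys` and `k + 1` linking vertices on the red cycle.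
    record Woven (F : List (Fin M)) (w v : Fin M) : Set where
      field
        ss zs links : List (Fin M)
        walk : Walk B w zs v
        perm : zs ↭ ss ++ links
        len-ss : length ss ≡ k
        len-xs : length links ≡ suc k
        unique-xs : Unique links
        xs-on : ∀ {x} → x ∈ˡ links → x ∈ˡ on
        unique-ss : Unique ss
        ss-fresh : ∀ {s} → s ∈ˡ ss → s ∈ˡ Ys × s ∉ F

    woven : ∀ F w v → length F ≤ 5 → w ∈ˡ F → v ∈ˡ F → w ∈ˡ Ys → v ∈ˡ Ys → v ≢ w → Woven F w v
    woven F w v len5 wF vF wY vY ne with pick-many Fin._≟_ k Ys F uY (≤-trans (+-monoˡ-≤ k len5) big)
    ... | ss , len , us , fresh with weave Fin._≟_ B? on uC (suc k) (_∈ˡ Ys)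
            -- With `m = k + 2` there are at least `k + 1` common blue neighbours, and at most `k`
            -- links are in use when the next one is chosen.
            (λ p q n → ≤-pred (link stuck (plainY p) (plainY q) n)) [] w ss v
            (vY ∷ wY ∷ All.tabulate (proj₁ ∘ fresh))
            (Unique-∷ (λ { (here e) → ne e ; (there p) → proj₂ (fresh p) vF }) (Unique-∷ (λ p → proj₂ (fresh p) wF) us))
            (s≤s (≤-reflexive len))
    ... | zs , xs , wk , perm , lx , ux , hx = record
      { ss = ss ; zs = zs ; links = xs ; walk = wk ; perm = perm ; len-ss = len ; len-xs = trans lx (cong suc len)
      ; unique-xs = ux ; xs-on = proj₁ ∘ hx ; unique-ss = us ; ss-fresh = fresh }

    -- `F` and the links number `6 + k`; the `k` vertices of `ss` bring the length to `2 * k + 6`,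
    -- two more than that of the red cycle.
    finish : ∀ {F w v l} (W : Woven F w v) xs → length F + length xs ≡ 6 + k → Unique F → (∀ {f} → f ∈ˡ F → f ∉ on) →
      Unique xs → (∀ {x} → x ∈ˡ xs → x ∈ˡ on) → Walk B v l w → (v ∷ l ++ w ∷ Woven.zs W) ↭ F ++ Woven.ss W ++ xs → Goal
    finish {F} {w} {v} {l} W xs len uF offF ux onx wk p = not b , mkCycle v (l ++ w ∷ zs)
      (trans (Perm.↭-length p) (trans (length-++ F) (trans (cong (length F +_) (trans (length-++ ss) (cong (_+ length xs) len-ss)))
        (trans (lem₁ (length F) k (length xs)) (trans (cong (k +_) len) (lem₂ k))))))
      (Unique-↭ (↭-sym p) (Unique-++ uF (Unique-++ unique-ss ux (λ s x → offY (proj₁ (ss-fresh s)) (onx x)))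
        (λ f q → [ (λ s → proj₂ (ss-fresh s) f) , offF f ∘ onx ]′ (∈-++⁻ ss q))))
      (walk-++ v l w zs wk walk)
      where
      open Woven W using (ss; zs; perm; walk; len-ss; unique-ss; ss-fresh)
      lem₁ : ∀ a k c → a + (k + c) ≡ k + (a + c)
      lem₁ = solve-∀
      lem₂ : ∀ k → k + (6 + k) ≡ 2 * suc (suc (suc k))
      lem₂ = solve-∀

  -- Only the ends have to lie in `Ys`. The inner vertices merely avoid the red cycle, which admits
  -- a mixed vertex.
  five : ∀ v₁ v₂ v₃ v₄ v₅ → Unique (v₁ ∷ v₂ ∷ v₃ ∷ v₄ ∷ v₅ ∷ []) → (∀ {f} → f ∈ˡ v₁ ∷ v₂ ∷ v₃ ∷ v₄ ∷ v₅ ∷ [] → f ∉ on) →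
    v₁ ∈ˡ Ys → v₅ ∈ˡ Ys → Walk B v₁ (v₂ ∷ v₃ ∷ v₄ ∷ []) v₅ → Goal
  five v₁ v₂ v₃ v₄ v₅ u off y₁ y₅ wk = finish {l = v₂ ∷ v₃ ∷ v₄ ∷ []} W (Woven.links W) (cong (5 +_) (Woven.len-xs W)) u off
      (Woven.unique-xs W) (Woven.xs-on W) wk (Perm.++⁺ˡ F (Woven.perm W))
    where
    F = v₁ ∷ v₂ ∷ v₃ ∷ v₄ ∷ v₅ ∷ []
    W = woven F v₅ v₁ ≤-refl (there (there (there (there (here refl))))) (here refl) y₅ y₁
      (λ e → head∉ u (there (there (there (here e)))))

  private
    -- One vertex short of `five`: an extra link `x` joins the non-blue pair. It exists because
    -- `link-nonblue` offers `k + 2` candidates and the walk uses `k + 1` of them.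
    four : ∀ w₁ w₂ w₃ w₄ p q → Unique (w₁ ∷ w₂ ∷ w₃ ∷ w₄ ∷ []) → (∀ {f} → f ∈ˡ w₁ ∷ w₂ ∷ w₃ ∷ w₄ ∷ [] → f ∉ on) →
      w₁ ∈ˡ Ys → w₄ ∈ˡ Ys → p ∈ˡ Ys → q ∈ˡ Ys → p ≢ q → ¬ B p q →
      (∀ x → B p x → B x q → ∃ λ l → Walk B w₁ l w₄ × (w₁ ∷ l ++ [ w₄ ]) ↭ x ∷ w₁ ∷ w₂ ∷ w₃ ∷ w₄ ∷ []) → Goal
    four w₁ w₂ w₃ w₄ p q u off y₁ y₄ yp yq ne ¬bl shape
      with woven (w₁ ∷ w₂ ∷ w₃ ∷ w₄ ∷ []) w₄ w₁ (n≤1+n 4) (there (there (there (here refl)))) (here refl) y₄ y₁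
        (λ e → head∉ u (there (there (here e))))
    ... | W with pick Fin._≟_ (common Fin._≟_ B? on uC p q) (Woven.links W) (Uniq.filter⁺ (λ x → B? p x ×-dec B? x q) uC)
          (subst (_< length (common Fin._≟_ B? on uC p q)) (sym (Woven.len-xs W)) (link-nonblue stuck (plainY yp) (plainY yq) ne ¬bl))
    ... | x , x∈ , x∉ with ∈-filter⁻ (λ x → B? p x ×-dec B? x q) {xs = on} x∈
    ... | x∈on , bp , bq with shape x bp bq
    ... | l , wk , perm = finish {l = l} W (x ∷ links) (cong (λ t → 5 + t) len-xs) u off (Unique-∷ x∉ unique-xs)
        (λ { (here refl) → x∈on ; (there r) → xs-on r }) wk
        (↭-trans (↭-reflexive (sym (++-assoc (w₁ ∷ l) [ w₄ ] zs)))
        (↭-trans (Perm.++⁺ perm (Woven.perm W))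
        (↭-sym (↭-trans (↭-reflexive (sym (++-assoc (w₁ ∷ w₂ ∷ w₃ ∷ w₄ ∷ []) ss (x ∷ links))))
          (↭-trans (Perm.shift x (w₁ ∷ w₂ ∷ w₃ ∷ w₄ ∷ ss) links) (↭-reflexive refl))))))
      where open Woven W hiding (walk; perm)

  two-edges-cycle : ∀ q p p′ q′ → Unique (q ∷ p ∷ p′ ∷ q′ ∷ []) → q ∈ˡ Ys → p ∈ˡ Ys → p′ ∈ˡ Ys → q′ ∈ˡ Ys →
    B q p → B p′ q′ → ¬ B p p′ → Goal
  two-edges-cycle q p p′ q′ u yq yp yp′ yq′ e e′ ¬bl = four q p p′ q′ p p′ u
    (λ { (here refl) → offY yq ; (there (here refl)) → offY yp ; (there (there (here refl))) → offY yp′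
       ; (there (there (there (here refl)))) → offY yq′ })
    yq yq′ yp yp′ (λ { refl → case u of λ { (_ ∷ (ne ∷ _) ∷ _) → ne refl } }) ¬bl
    (λ x b₁ b₂ → p ∷ x ∷ p′ ∷ [] , (e , b₁ , b₂ , e′) , Perm.shift x (q ∷ p ∷ []) (p′ ∷ q′ ∷ []))

  private
    path-plus : ∀ p q r a → Unique (p ∷ q ∷ r ∷ a ∷ []) → q ∉ on → p ∈ˡ Ys → r ∈ˡ Ys → a ∈ˡ Ys → B p q → B q r → ¬ B r a → Goal
    path-plus p q r a u oq yp yr ya e e′ ¬bl = four p q r a r a u
      (λ { (here refl) → offY yp ; (there (here refl)) → oq ; (there (there (here refl))) → offY yr
         ; (there (there (there (here refl)))) → offY ya })
      yp ya yr ya (λ { refl → case u of λ { (_ ∷ _ ∷ (ne ∷ _) ∷ _) → ne refl } }) ¬bl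
      (λ x b₁ b₂ → q ∷ r ∷ x ∷ [] , (e , e′ , b₁ , b₂) , Perm.shift x (p ∷ q ∷ r ∷ []) (a ∷ []))

  -- Two blue edges p q and q r: the path either extends to a blue path on five
  -- vertices, or one of its ends has a non-blue pair, which gives an extra link.
  path-cycle : ∀ p q r → p ≢ r → q ∉ on → p ∈ˡ Ys → r ∈ˡ Ys → B p q → B q r → Goal
  path-cycle p q r p≢r oq yp yr e e′ with any? (λ a → ¬? (a ∈? p ∷ q ∷ r ∷ []) ×-dec ¬? (B? r a)) Ys
      | any? (λ a → ¬? (a ∈? p ∷ q ∷ r ∷ []) ×-dec ¬? (B? p a)) Ys
  ... | yes w | _ = let (a , ya , a∉ , ¬bl) = find w in
    path-plus p q r a
      (Unique-∷ (λ { (here x) → E-≢ e x ; (there (here x)) → p≢r x ; (there (there (here x))) → a∉ (here (sym x)) })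
      (Unique-∷ (λ { (here x) → E-≢ e′ x ; (there (here x)) → a∉ (there (here (sym x))) })
      (Unique-∷ (λ { (here x) → a∉ (there (there (here (sym x)))) }) ([] ∷ []))))
      oq yp yr ya e e′ ¬bl
  ... | no _ | yes w = let (a , ya , a∉ , ¬bl) = find w in
    path-plus r q p a
      (Unique-∷ (λ { (here x) → E-≢ e′ (sym x) ; (there (here x)) → p≢r (sym x)
                  ; (there (there (here x))) → a∉ (there (there (here (sym x)))) })
      (Unique-∷ (λ { (here x) → E-≢ e (sym x) ; (there (here x)) → a∉ (there (here (sym x))) })
      (Unique-∷ (λ { (here x) → a∉ (here (sym x)) }) ([] ∷ []))))
      oq yr yp ya (E-sym e′) (E-sym e) ¬bl
  ... | no ¬r | no ¬p with pick-many Fin._≟_ 2 Ys (p ∷ q ∷ r ∷ []) uY (≤-trans (m≤m+n 5 k) big)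
  ... | a ∷ a′ ∷ [] , refl , ((a≢a′ ∷ []) ∷ _) , fresh =
    five a p q r a′
      (Unique-∷ (λ { (here x) → a∉ (here x) ; (there (here x)) → a∉ (there (here x))
                  ; (there (there (here x))) → a∉ (there (there (here x))) ; (there (there (there (here x)))) → a≢a′ x })
      (Unique-∷ (λ { (here x) → E-≢ e x ; (there (here x)) → p≢r x ; (there (there (here x))) → a′∉ (here (sym x)) })
      (Unique-∷ (λ { (here x) → E-≢ e′ x ; (there (here x)) → a′∉ (there (here (sym x))) })
      (Unique-∷ (λ { (here x) → a′∉ (there (there (here (sym x)))) }) ([] ∷ [])))))
      (λ { (here refl) → offY ya ; (there (here refl)) → offY yp ; (there (there (here refl))) → oq
         ; (there (there (there (here refl)))) → offY yr ; (there (there (there (there (here refl))))) → offY ya′ })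
      ya ya′ (E-sym (blue-p ya a∉) , e , e′ , blue-r ya′ a′∉)
    where
    ya = proj₁ (fresh (here refl))
    a∉ = proj₂ (fresh (here refl))
    ya′ = proj₁ (fresh (there (here refl)))
    a′∉ = proj₂ (fresh (there (here refl)))
    blue-p : ∀ {a} → a ∈ˡ Ys → a ∉ p ∷ q ∷ r ∷ [] → B p a
    blue-p {a} y n = decidable-stable (B? p a) λ ¬b → ¬p (lose y (n , ¬b))
    blue-r : ∀ {a} → a ∈ˡ Ys → a ∉ p ∷ q ∷ r ∷ [] → B r a
    blue-r {a} y n = decidable-stable (B? r a) λ ¬b → ¬r (lose y (n , ¬b))

at-most-one : ∀ {A : Set} {xs : List A} → Unique xs → (∀ {x y} → x ∈ˡ xs → y ∈ˡ xs → ¬ x ≢ y) → length xs ≤ 1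
at-most-one {xs = []} _ _ = z≤n
at-most-one {xs = x ∷ []} _ _ = ≤-refl
at-most-one {xs = x ∷ y ∷ _} ((n ∷ _) ∷ _) f = ⊥-elim (f (here refl) (there (here refl)) n)

-- From a monochromatic cycle of length 2m to one of length 2m + 2.

module Growth {M : ℕ} (T : TwinColouring M) (n : ℕ) (4n≤M : 4 * n ≤ M)
  (small : ClassesAtMost (TwinColouring.label T) n (allFin M)) (k : ℕ) (m<n : suc (suc k) < n)
  (b : Bool) (C : Cycle (TwinColouring.E T b) (2 * suc (suc k))) where
  open TwinColouring T
  open Large T n 4n≤M small
  open Stuck T b (suc (suc k)) C

  private
    m : ℕ
    m = suc (suc k)
    Goal = MonoCyc (2 * suc m)

    all = allFin M
    out? : U.Decidable (_∉ on)
    out? v = ¬? (v ∈? on)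

    out = filter out? all
    unique-out : Unique out
    unique-out = Uniq.filter⁺ out? (Uniq.allFin⁺ M)

    out-big : 2 * m + 4 ≤ length out
    out-big = +-cancelˡ-≤ (2 * m) _ _ (begin
      2 * m + (2 * m + 4) ≡⟨ lem m ⟩
      4 * suc m ≤⟨ *-monoʳ-≤ 4 m<n ⟩
      4 * n ≤⟨ 4n≤M ⟩
      M ≡⟨ sym (trans (filter-++¬ (_∈? on) all) (length-tabulate id)) ⟩
      length (filter (_∈? on) all) + length out ≤⟨ +-monoˡ-≤ _ (≤-trans
        (unique-⊆-length (Uniq.filter⁺ (_∈? on) (Uniq.allFin⁺ M)) (filter-holds (_∈? on) {all})) (≤-reflexive lenC)) ⟩
      2 * m + length out ∎)
      where
      open ≤-Reasoning
      lem : ∀ m → 2 * m + (2 * m + 4) ≡ 4 * suc m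
      lem = solve-∀

    mixed = filter Mixed? out
    unmixed = filter (¬? ∘ Mixed?) out
    unique-unmixed : Unique unmixed
    unique-unmixed = Uniq.filter⁺ (¬? ∘ Mixed?) unique-out

  module _ (stuck : ∀ y y′ → ¬ Growable y y′) (classes : ClassesAtMost label m all) where

    private
      out-off : ∀ {y} → y ∈ˡ out → y ∉ on
      out-off = filter-holds out? {all}

      -- A red edge here would lengthen the cycle by `insert-twin`.
      mixed-blue : ∀ {u y} → u ∈ˡ out → Mixed u → y ∈ˡ out → label u ≢ label y → B u y
      mixed-blue {u} {y} u∈ mx y∈ ne = [ (λ r → ⊥-elim (stuck u y (out-off u∈ , out-off y∈ , inj₁ (r , mx)))) , id ]′ (E-either b ne)

      mixed-label : ∀ {u y} → label u ≡ label y → Mixed u → Mixed y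
      mixed-label e = Any.map (λ p → trans p e)

      -- By `mixed-blue`, blue contains a complete multipartite graph on `out`: its classes are the
      -- label classes of mixed vertices, and one class, with key 0, of all unmixed vertices.
      few-unmixed : length unmixed ≤ m → Goal
      few-unmixed le = not b , multipartite-cycle key E-sym m out unique-out
          (≤-trans (≤-trans (≤-reflexive (lem m)) (+-monoʳ-≤ (2 * m) (s≤s (s≤s z≤n)))) out-big) count blue
        where
        lem : ∀ m → 2 * suc m ≡ 2 * m + 2
        lem = solve-∀
        key : Fin M → ℕ
        key y with Mixed? y
        ... | yes _ = suc (label y)
        ... | no _ = 0
        count : ClassesAtMost key m out
        count zero = ≤-trans (filter-mono (λ v → key v ≟ 0) (¬? ∘ Mixed?) out out unique-out f) le
          where
          f : ∀ {x} → x ∈ˡ out → key x ≡ 0 → x ∈ˡ out × ¬ Mixed x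
          f {x} x∈ e with Mixed? x
          f x∈ () | yes _
          ... | no ¬m = x∈ , ¬m
        count (suc c) = ≤-trans (filter-mono (λ v → key v ≟ suc c) (λ v → label v ≟ c) out all unique-out f) (classes c)
          where
          f : ∀ {x} → x ∈ˡ out → key x ≡ suc c → x ∈ˡ all × label x ≡ c
          f {x} x∈ e with Mixed? x
          ... | yes _ = ∈-allFin x , suc-injective e
          f x∈ () | no _
        blue : ∀ {x y} → x ∈ˡ out → y ∈ˡ out → key x ≢ key y → B x y
        blue {x} {y} x∈ y∈ ne with Mixed? x | Mixed? y
        ... | yes mx | yes _ = mixed-blue x∈ mx y∈ (ne ∘ cong suc)
        ... | yes mx | no ¬my = mixed-blue x∈ mx y∈ (λ e → ¬my (mixed-label e mx))
        ... | no ¬mx | yes my = E-sym (mixed-blue y∈ my x∈ (λ e → ¬mx (mixed-label e my)))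
        ... | no _ | no _ = ⊥-elim (ne refl)

      mixed-unmixed : ∀ {u y} → u ∈ˡ mixed → y ∈ˡ unmixed → B u y
      mixed-unmixed u∈ y∈ =
        let (u∈out , mu) = ∈-filter⁻ Mixed? {xs = out} u∈ ; (y∈out , ¬my) = ∈-filter⁻ (¬? ∘ Mixed?) {xs = out} y∈
        in mixed-blue u∈out mu y∈out (λ e → ¬my (mixed-label e mu))

      many-mixed : suc m ≤ length mixed → suc m ≤ length unmixed → Goal
      many-mixed le le′ = not b , bip E-sym E-≢ m mixed unmixed le le′ (Uniq.filter⁺ Mixed? unique-out) unique-unmixed mixed-unmixed

      Ys = filter (¬? ∘ Heavy?) unmixed
      unique-Ys : Unique Ys
      unique-Ys = Uniq.filter⁺ (¬? ∘ Heavy?) unique-unmixed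

      Ys-plain : ∀ {y} → y ∈ˡ Ys → Plain stuck y
      Ys-plain y∈ = let (y∈u , l) = ∈-filter⁻ (¬? ∘ Heavy?) {xs = unmixed} y∈ ; (y∈o , ¬mx) = ∈-filter⁻ (¬? ∘ Mixed?) {xs = out} y∈u
        in plain (out-off y∈o) ¬mx l

      -- Two heavy vertices could be inserted together by `heavy-unique`, so at most one vertex is
      -- discarded.
      Ys-big : length unmixed ≤ suc (length Ys)
      Ys-big = ≤-trans (≤-reflexive (sym (filter-++¬ Heavy? unmixed))) (+-monoˡ-≤ _ (at-most-one (Uniq.filter⁺ Heavy? unique-unmixed) same))
        where
        same : ∀ {x y} → x ∈ˡ filter Heavy? unmixed → y ∈ˡ filter Heavy? unmixed → ¬ x ≢ y
        same {x} {y} x∈ y∈ ne =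
          let (x∈u , hx) = ∈-filter⁻ Heavy? {xs = unmixed} x∈ ; (y∈u , hy) = ∈-filter⁻ Heavy? {xs = unmixed} y∈
              off = λ {z} (z∈ : z ∈ˡ unmixed) → out-off (filter-⊆ (¬? ∘ Mixed?) {out} z∈)
          in stuck x y (off x∈u , off y∈u , inj₂ (inj₂ (inj₂ (inj₁ (ne , hx , ≤-trans (n≤1+n 1) hy)))))

      no-blue : ∀ zs → Unique zs → 2 * suc m ≤ length zs → (∀ {p q} → p ∈ˡ zs → q ∈ˡ zs → ¬ B p q) → Goal
      no-blue zs u le none = b , multipartite-cycle label E-sym m zs u le
        (λ c → ≤-trans (filter-mono (λ v → label v ≟ c) (λ v → label v ≟ c) zs all u (λ {x} _ e → ∈-allFin x , e)) (classes c))
        (λ x∈ y∈ ne → [ id , ⊥-elim ∘ none x∈ y∈ ]′ (E-either b ne))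

      blue-edge : ∀ zs → (∃ λ p → ∃ λ q → p ∈ˡ zs × q ∈ˡ zs × B p q) ⊎ (∀ {p q} → p ∈ˡ zs → q ∈ˡ zs → ¬ B p q)
      blue-edge zs with any? (λ p → any? (B? p) zs) zs
      ... | yes w = let (p , p∈ , w′) = find w ; (q , q∈ , e) = find w′ in inj₁ (p , q , p∈ , q∈ , e)
      ... | no ¬w = inj₂ λ p∈ q∈ e → ¬w (lose p∈ (lose q∈ e))

      module _ (big : 5 + k ≤ length Ys) where
        open Weaving T b k C stuck Ys unique-Ys Ys-plain big

        Ys-unmixed : ∀ {y} → y ∈ˡ Ys → y ∈ˡ unmixed
        Ys-unmixed = filter-⊆ (¬? ∘ Heavy?)

        with-mixed : ∀ {u} → u ∈ˡ mixed → Goal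
        with-mixed {u} u∈ with pick-many Fin._≟_ 2 Ys [] unique-Ys (≤-trans (s≤s (s≤s z≤n)) big)
        ... | p ∷ r ∷ [] , refl , ((ne ∷ []) ∷ _) , fresh = path-cycle p u r ne (out-off (filter-⊆ Mixed? {out} u∈))
          (proj₁ (fresh (here refl))) (proj₁ (fresh (there (here refl))))
          (E-sym (mixed-unmixed u∈ (Ys-unmixed (proj₁ (fresh (here refl))))))
          (mixed-unmixed u∈ (Ys-unmixed (proj₁ (fresh (there (here refl))))))

        without-mixed : 2 * m + 3 ≤ length Ys → Goal
        without-mixed huge with blue-edge Ys
        ... | inj₂ none = no-blue Ys unique-Ys (≤-trans (≤-trans (≤-reflexive (lem m)) (+-monoʳ-≤ (2 * m) (s≤s (s≤s z≤n)))) huge) none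
          where
          lem : ∀ m → 2 * suc m ≡ 2 * m + 2
          lem = solve-∀
        -- Deleting only `p` keeps at least `2 * m + 2` vertices. A second blue edge then avoids `p`
        -- but may still contain `q`.
        ... | inj₁ (p , q , p∈ , q∈ , e) with blue-edge rest
          where
          rest = filter (λ z → ¬? (z Fin.≟ p)) Ys
        ... | inj₂ none = no-blue _ (Uniq.filter⁺ (λ z → ¬? (z Fin.≟ p)) unique-Ys) rest-big none
          where
          lem : ∀ m → suc (2 * suc m) ≡ 2 * m + 3
          lem = solve-∀
          rest-big : 2 * suc m ≤ length (filter (λ z → ¬? (z Fin.≟ p)) Ys)
          rest-big = ≤-pred (≤-trans (≤-reflexive (lem m)) (≤-trans huge (≤-trans (≤-reflexive (sym (filter-++¬ (λ z → z Fin.≟ p) Ys)))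
            (+-monoˡ-≤ _ (at-most-one (Uniq.filter⁺ (λ z → z Fin.≟ p) unique-Ys)
              (λ x∈ y∈ ne → ne (trans (filter-holds (λ z → z Fin.≟ p) {Ys} x∈) (sym (filter-holds (λ z → z Fin.≟ p) {Ys} y∈)))))))))
        ... | inj₁ (p′ , q′ , p′∈r , q′∈r , e′) = cases (p′ Fin.≟ q) (q′ Fin.≟ q) (B? p p′)
          where
          in-rest : ∀ {z} → z ∈ˡ filter (λ z → ¬? (z Fin.≟ p)) Ys → z ∈ˡ Ys × z ≢ p
          in-rest = ∈-filter⁻ (λ z → ¬? (z Fin.≟ p)) {xs = Ys}
          p′∈ = proj₁ (in-rest p′∈r)
          q′∈ = proj₁ (in-rest q′∈r)
          p′≢p = proj₂ (in-rest p′∈r)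
          q′≢p = proj₂ (in-rest q′∈r)
          offY : ∀ {y} → y ∈ˡ Ys → y ∉ on
          offY = Plain.off ∘ Ys-plain
          -- If the two edges share `q`, or `p` and `p′` are joined in blue, there is a blue path
          -- with two edges; otherwise `p` and `p′` form the non-blue pair that joins the two edges.
          cases : Dec (p′ ≡ q) → Dec (q′ ≡ q) → Dec (B p p′) → Goal
          cases (yes refl) _ _ = path-cycle p q q′ (q′≢p ∘ sym) (offY q∈) p∈ q′∈ e e′
          cases (no _) (yes refl) _ = path-cycle p q p′ (p′≢p ∘ sym) (offY q∈) p∈ p′∈ e (E-sym e′)
          cases (no p′≢q) (no q′≢q) (yes f) = path-cycle q p p′ (p′≢q ∘ sym) (offY p∈) q∈ p′∈ (E-sym e) f
          cases (no p′≢q) (no q′≢q) (no ¬f) = two-edges-cycle q p p′ q′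
            (Unique-∷ (λ { (here x) → E-≢ e (sym x) ; (there (here x)) → p′≢q (sym x) ; (there (there (here x))) → q′≢q (sym x) })
            (Unique-∷ (λ { (here x) → p′≢p (sym x) ; (there (here x)) → q′≢p (sym x) })
            (Unique-∷ (λ { (here x) → E-≢ e′ x }) ([] ∷ []))))
            q∈ p∈ p′∈ q′∈ (E-sym e) e′ ¬f

      sum : length mixed + length unmixed ≡ length out
      sum = filter-++¬ Mixed? out

    stuck-cycle : Goal
    stuck-cycle with length unmixed ≤? m | suc m ≤? length mixed
    ... | yes le | _ = few-unmixed le
    ... | no ¬le | yes le′ = many-mixed le′ (≰⇒> ¬le)
    -- At most `m` of at least `2 * m + 4` vertices are mixed, so at least `m + 4` are unmixed and
    -- at least `m + 3 = 5 + k` of these are light.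
    ... | no _ | no ¬le′ = go mixed refl
      where
      lem : ∀ k → suc (suc k) + (6 + k) ≡ 2 * suc (suc k) + 4
      lem = solve-∀
      lem′ : ∀ m → suc (2 * m + 3) ≡ 2 * m + 4
      lem′ = solve-∀
      big : 5 + k ≤ length Ys
      big = ≤-pred (≤-trans (+-cancelˡ-≤ m _ _ (≤-trans (≤-reflexive (lem k)) (≤-trans out-big
        (≤-trans (≤-reflexive (sym sum)) (+-monoˡ-≤ _ (≤-pred (≰⇒> ¬le′))))))) Ys-big)
      go : ∀ us → mixed ≡ us → Goal
      go (u ∷ us) eq = with-mixed big (subst (u ∈ˡ_) (sym eq) (here refl))
      go [] eq = without-mixed big (≤-pred (≤-trans (≤-reflexive (lem′ m)) (≤-trans out-big
        (≤-trans (≤-reflexive (trans (sym sum) (cong (λ t → length t + length unmixed) eq))) Ys-big))))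

  growth : Goal
  growth with stuck-or | small-classes m m<n
  ... | inj₂ g | _ = g
  ... | inj₁ _ | inj₂ g = g
  ... | inj₁ stuck | inj₁ classes = stuck-cycle stuck classes

-- Monochromatic four-cycles.

module Base {M : ℕ} (T : TwinColouring M) where
  open TwinColouring T

  four-cycle : ∀ {b} w x y z → E b w x → E b x y → E b y z → E b z w → w ≢ y → x ≢ z → MonoCyc 4
  four-cycle {b} w x y z wx xy yz zw w≢y x≢z = b , mkCycle w (x ∷ y ∷ z ∷ []) refl
    (Unique-∷ (λ { (here e) → E-≢ wx e ; (there (here e)) → w≢y e ; (there (there (here e))) → E-≢ zw (sym e) })
    (Unique-∷ (λ { (here e) → E-≢ xy e ; (there (here e)) → x≢z e })
    (Unique-∷ (λ { (here e) → E-≢ yz e }) ([] ∷ []))))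
    (wx , xy , yz , zw)

  -- Two red edges at the same vertex close up through v; otherwise the red edges
  -- among the four neighbours of v form a matching, whose complement contains C₄.
  four-neighbours : ∀ b v x₁ x₂ x₃ x₄ → Unique (x₁ ∷ x₂ ∷ x₃ ∷ x₄ ∷ []) →
    E b v x₁ → E b v x₂ → E b v x₃ → E b v x₄ →
    (∀ {x y} → x ≢ y → label x ≢ label y) → MonoCyc 4
  four-neighbours b v x₁ x₂ x₃ x₄ ((n₁₂ ∷ n₁₃ ∷ n₁₄ ∷ []) ∷ (n₂₃ ∷ n₂₄ ∷ []) ∷ (n₃₄ ∷ []) ∷ _) e₁ e₂ e₃ e₄ inj =
      go (col n₁₂) (col n₁₃) (col n₁₄) (col n₂₃) (col n₂₄) (col n₃₄)
    where
    col : ∀ {x y} → x ≢ y → E b x y ⊎ E (not b) x y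
    col ne = E-either b (inj ne)
    close : ∀ {x y z} → x ≢ z → E b v x → E b v y → E b v z → E b x y → E b y z → MonoCyc 4
    close {x} {y} {z} ne ex ey ez xy yz = four-cycle v x y z ex xy yz (E-sym ez) (E-≢ ey) ne
    Col : Fin M → Fin M → Set
    Col x y = E b x y ⊎ E (not b) x y
    go : Col x₁ x₂ → Col x₁ x₃ → Col x₁ x₄ → Col x₂ x₃ → Col x₂ x₄ → Col x₃ x₄ → MonoCyc 4
    go (inj₁ a) (inj₁ c) _ _ _ _ = close n₂₃ e₂ e₁ e₃ (E-sym a) c
    go (inj₁ a) (inj₂ _) (inj₁ d) _ _ _ = close n₂₄ e₂ e₁ e₄ (E-sym a) d
    go (inj₁ a) (inj₂ _) (inj₂ _) (inj₁ f) _ _ = close n₁₃ e₁ e₂ e₃ a f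
    go (inj₁ a) (inj₂ _) (inj₂ _) (inj₂ _) (inj₁ g) _ = close n₁₄ e₁ e₂ e₄ a g
    go (inj₁ _) (inj₂ c) (inj₂ d) (inj₂ f) (inj₂ g) _ = four-cycle x₁ x₃ x₂ x₄ c (E-sym f) g (E-sym d) n₁₂ n₃₄
    go (inj₂ _) (inj₁ c) (inj₁ d) _ _ _ = close n₃₄ e₃ e₁ e₄ (E-sym c) d
    go (inj₂ _) (inj₁ c) (inj₂ _) (inj₁ f) _ _ = close n₁₂ e₁ e₃ e₂ c (E-sym f)
    go (inj₂ _) (inj₁ c) (inj₂ _) (inj₂ _) _ (inj₁ h) = close n₁₄ e₁ e₃ e₄ c h
    go (inj₂ a) (inj₁ _) (inj₂ d) (inj₂ f) _ (inj₂ h) = four-cycle x₁ x₂ x₃ x₄ a f h (E-sym d) n₁₃ n₂₄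
    go (inj₂ a) (inj₂ c) _ _ (inj₂ g) (inj₂ h) = four-cycle x₁ x₂ x₄ x₃ a g (E-sym h) (E-sym c) n₁₄ n₂₃
    go (inj₂ _) (inj₂ _) (inj₁ d) _ (inj₁ g) _ = close n₁₂ e₁ e₄ e₂ d (E-sym g)
    go (inj₂ _) (inj₂ _) (inj₁ d) _ (inj₂ _) (inj₁ h) = close n₁₃ e₁ e₄ e₃ d (E-sym h)
    go (inj₂ a) (inj₂ _) (inj₂ d) (inj₁ f) (inj₁ g) _ = close n₃₄ e₃ e₂ e₄ (E-sym f) g
    go (inj₂ _) (inj₂ _) (inj₂ _) _ (inj₁ g) (inj₁ h) = close n₂₃ e₂ e₄ e₃ g (E-sym h)
    go (inj₂ a) (inj₂ _) (inj₂ d) (inj₂ f) (inj₁ _) (inj₂ h) = four-cycle x₁ x₂ x₃ x₄ a f h (E-sym d) n₁₃ n₂₄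
    go (inj₂ _) (inj₂ _) (inj₂ _) (inj₁ f) (inj₂ _) (inj₁ h) = close n₂₄ e₂ e₃ e₄ f h
    go (inj₂ _) (inj₂ c) (inj₂ d) (inj₂ f) (inj₂ g) (inj₁ _) = four-cycle x₁ x₃ x₂ x₄ c (E-sym f) g (E-sym d) n₁₂ n₃₄

  module _ (9≤M : 9 ≤ M) where

    private
      all = allFin M
      uAll = Uniq.allFin⁺ M

      majority : ∀ v → (∀ w → w ≢ v → label v ≢ label w) → ∃ λ b → ∃ λ ws → 4 ≤ length ws × Unique ws × (∀ {w} → w ∈ˡ ws → E b v w)
      majority v ne = go (4 ≤? length reds)
        where
        rest = filter (λ w → ¬? (w Fin.≟ v)) all
        reds = filter (E? true v) rest
        blues = filter (¬? ∘ E? true v) rest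
        u-rest : Unique rest
        u-rest = Uniq.filter⁺ (λ w → ¬? (w Fin.≟ v)) uAll
        rest-big : 8 ≤ length rest
        rest-big = ≤-pred (≤-trans 9≤M (≤-trans (≤-reflexive (sym (trans (filter-++¬ (Fin._≟ v) all) (length-tabulate id))))
          (+-monoˡ-≤ _ (at-most-one (Uniq.filter⁺ (Fin._≟ v) uAll)
            (λ x∈ y∈ n → n (trans (filter-holds (Fin._≟ v) {all} x∈) (sym (filter-holds (Fin._≟ v) {all} y∈))))))))
        go : Dec (4 ≤ length reds) → ∃ λ b → ∃ λ ws → 4 ≤ length ws × Unique ws × (∀ {w} → w ∈ˡ ws → E b v w)
        go (yes le) = true , reds , le , Uniq.filter⁺ (E? true v) u-rest , λ w∈ → filter-holds (E? true v) {rest} w∈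
        go (no ¬le) = false , blues , le , Uniq.filter⁺ (¬? ∘ E? true v) u-rest , blue
          where
          le : 4 ≤ length blues
          le = +-cancelˡ-≤ 4 _ _ (≤-trans rest-big (≤-trans (≤-reflexive (sym (filter-++¬ (E? true v) rest)))
            (+-monoˡ-≤ _ (≤-trans (n≤1+n _) (≰⇒> ¬le)))))
          blue : ∀ {w} → w ∈ˡ blues → E false v w
          blue w∈ = let (w∈rest , ¬e) = ∈-filter⁻ (¬? ∘ E? true v) {xs = rest} w∈
            in [ ⊥-elim ∘ ¬e , id ]′ (E-or (ne _ (filter-holds (λ w → ¬? (w Fin.≟ v)) {all} w∈rest)))

    singletons-C₄ : (∀ {x y} → x ≢ y → label x ≢ label y) → Fin M → MonoCyc 4
    singletons-C₄ inj v with majority v (λ w ne → inj (ne ∘ sym))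
    ... | b , ws , le , u , f with pick-many Fin._≟_ 4 ws [] u le
    ... | zs , len , u′ , g = go zs len u′ (f ∘ proj₁ ∘ g)
      where
      go : ∀ zs → length zs ≡ 4 → Unique zs → (∀ {z} → z ∈ˡ zs → E b v z) → MonoCyc 4
      go (x₁ ∷ x₂ ∷ x₃ ∷ x₄ ∷ []) _ u f = four-neighbours b v x₁ x₂ x₃ x₄ u
        (f (here refl)) (f (there (here refl))) (f (there (there (here refl)))) (f (there (there (there (here refl))))) inj

-- Induction on the length of the cycle.

module Core {M : ℕ} (T : TwinColouring M) (n : ℕ) (4n≤M : 4 * n ≤ M)
  (small : ClassesAtMost (TwinColouring.label T) n (allFin M)) (2<n : 2 < n) where
  open TwinColouring T
  open Large T n 4n≤M small
  open Base T

  private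
    base : MonoCyc 4
    -- A repeated label already yields a four-cycle, so all labels may be taken to be distinct.
    base with small-classes 1 (≤-trans (n≤1+n 2) 2<n)
    ... | inj₂ g = g
    ... | inj₁ one = pick-vertex M refl
      where
      M≥9 : 9 ≤ M
      M≥9 = ≤-trans (≤-trans (m≤m+n 9 3) (*-monoʳ-≤ 4 2<n)) 4n≤M
      inj : ∀ {x y} → x ≢ y → label x ≢ label y
      inj {x} {y} ne e = <⇒≱ (unique-⊆-length {xs = x ∷ y ∷ []} ((ne ∷ []) ∷ [] ∷ [])
        (λ { (here refl) → ∈-filter⁺ (λ v → label v ≟ label y) (∈-allFin x) e
           ; (there (here refl)) → ∈-filter⁺ (λ v → label v ≟ label y) (∈-allFin y) refl })) (one (label y))
      pick-vertex : ∀ M′ → M′ ≡ M → MonoCyc 4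
      pick-vertex zero refl = case M≥9 of λ ()
      pick-vertex (suc _) refl = singletons-C₄ M≥9 inj zero

  even-cycle : ∀ k → suc k < n → MonoCyc (2 * suc (suc k))
  even-cycle zero _ = base
  even-cycle (suc k) lt with even-cycle k (≤-trans (n≤1+n _) lt)
  ... | b , C = Growth.growth T n 4n≤M small k lt b C

does-yes : ∀ {P : Set} (d : Dec P) → does d ≡ true → P
does-yes (yes p) _ = p

does-no : ∀ {P : Set} (d : Dec P) → does d ≡ false → ¬ P
does-no (no ¬p) _ = ¬p

-- Components and Gallai partitions

module _ {V : Set} where

  data Conn (R : V → V → Set) (H : List V) : V → V → Set where
    stop : ∀ {x} → Conn R H x x
    move : ∀ {x y z} → R x y → y ∈ˡ H → Conn R H y z → Conn R H x z

  module _ {R : V → V → Set} where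

    conn-trans : ∀ {H x y z} → Conn R H x y → Conn R H y z → Conn R H x z
    conn-trans stop q = q
    conn-trans (move r y∈ p) q = move r y∈ (conn-trans p q)

    conn-sym : ∀ {H x y} → (∀ {a b} → R a b → R b a) → x ∈ˡ H → Conn R H x y → Conn R H y x
    conn-sym s x∈ stop = stop
    conn-sym s x∈ (move r y∈ p) = conn-trans (conn-sym s y∈ p) (move (s r) x∈ stop)

    conn-weaken : ∀ {H v x y} → Conn R H x y → Conn R (v ∷ H) x y
    conn-weaken stop = stop
    conn-weaken (move r y∈ p) = move r (there y∈) (conn-weaken p)

    conn-invariant : ∀ {B : Set} {H x y} (f : V → B) → (∀ {a b} → a ∈ˡ H → b ∈ˡ H → R a b → f a ≡ f b) →
      x ∈ˡ H → Conn R H x y → f x ≡ f y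
    conn-invariant f h x∈ stop = refl
    conn-invariant f h x∈ (move r y∈ p) = trans (h x∈ y∈ r) (conn-invariant f h y∈ p)

  -- The bound on the labels keeps `length H` free as a fresh label when a vertex is added.
  record Components (R : V → V → Set) (H : List V) : Set where
    field
      label : V → ℕ
      bound : ∀ {x} → x ∈ˡ H → label x < length H
      respects : ∀ {x y} → x ∈ˡ H → y ∈ˡ H → R x y → label x ≡ label y
      connected : ∀ {x y} → x ∈ˡ H → y ∈ˡ H → label x ≡ label y → Conn R H x y

  module _ (_≟ⱽ_ : DecidableEquality V) {R : V → V → Set} (R? : ∀ x y → Dec (R x y)) (R-sym : ∀ {x y} → R x y → R y x) where

    -- The new vertex `v` and all old components containing a neighbour of `v` receive the fresh
    -- label; the other labels are kept.
    components : ∀ H → Unique H → Components R H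
    components [] _ = record { label = λ _ → 0 ; bound = λ () ; respects = λ () ; connected = λ () }
    components (v ∷ H) u@(_ ∷ uH) = record { label = ℓ ; bound = bd ; respects = rs ; connected = cn }
      where
      open Components (components H uH) renaming (label to ℓ′)
      Merged : V → Set
      Merged x = x ≡ v ⊎ Any (λ w → ℓ′ w ≡ ℓ′ x × R v w) H
      merged? : U.Decidable Merged
      merged? x = (x ≟ⱽ v) ⊎-dec any? (λ w → (ℓ′ w ≟ ℓ′ x) ×-dec R? v w) H
      ℓ : V → ℕ
      ℓ x with merged? x
      ... | yes _ = length H
      ... | no _ = ℓ′ x
      old : ∀ {x} → x ∈ˡ v ∷ H → ¬ Merged x → x ∈ˡ H
      old (here e) ¬m = ⊥-elim (¬m (inj₁ e))
      old (there x∈) _ = x∈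
      bd : ∀ {x} → x ∈ˡ v ∷ H → ℓ x < suc (length H)
      bd {x} x∈ with merged? x
      ... | yes _ = ≤-refl
      ... | no ¬m = ≤-trans (bound (old x∈ ¬m)) (n≤1+n _)
      moved : ∀ {x y} → x ∈ˡ v ∷ H → y ∈ˡ v ∷ H → R x y → Merged x → Merged y
      moved {x} {y} x∈ y∈ r m with y ≟ⱽ v
      ... | yes e = inj₁ e
      ... | no y≢v with old′ y∈
        where
        old′ : y ∈ˡ v ∷ H → y ∈ˡ H
        old′ (here e) = ⊥-elim (y≢v e)
        old′ (there p) = p
      ... | y∈H with m
      ... | inj₁ refl = inj₂ (lose y∈H (refl , r))
      ... | inj₂ a with x∈
      ... | here refl = inj₂ (lose y∈H (refl , r))
      ... | there x∈H = inj₂ (Any.map (λ (e , q) → trans e (respects x∈H y∈H r) , q) a)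
      rs : ∀ {x y} → x ∈ˡ v ∷ H → y ∈ˡ v ∷ H → R x y → ℓ x ≡ ℓ y
      rs {x} {y} x∈ y∈ r with merged? x | merged? y
      ... | yes _ | yes _ = refl
      ... | yes m | no ¬m = ⊥-elim (¬m (moved x∈ y∈ r m))
      ... | no ¬m | yes m = ⊥-elim (¬m (moved y∈ x∈ (R-sym r) m))
      ... | no ¬m | no ¬m′ = respects (old x∈ ¬m) (old y∈ ¬m′) r
      to-v : ∀ {x} → x ∈ˡ v ∷ H → Merged x → Conn R (v ∷ H) v x
      to-v _ (inj₁ refl) = stop
      to-v (here refl) (inj₂ _) = stop
      to-v (there x∈) (inj₂ a) = let (w , w∈ , e , r) = find a in move r (there w∈) (conn-weaken (connected w∈ x∈ e))
      cn : ∀ {x y} → x ∈ˡ v ∷ H → y ∈ˡ v ∷ H → ℓ x ≡ ℓ y → Conn R (v ∷ H) x y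
      cn {x} {y} x∈ y∈ e with merged? x | merged? y
      ... | yes m | yes m′ = conn-trans (conn-sym R-sym (here refl) (to-v x∈ m)) (to-v y∈ m′)
      ... | yes _ | no ¬m = ⊥-elim (<-irrefl (sym e) (bound (old y∈ ¬m)))
      ... | no ¬m | yes _ = ⊥-elim (<-irrefl e (bound (old x∈ ¬m)))
      ... | no ¬m | no ¬m′ = conn-weaken (connected (old x∈ ¬m) (old y∈ ¬m′) e)

-- Gallai's theorem: a cut in at most two colours.

module GallaiCut {N k : ℕ} (c : Coloring N k) (c-sym : Symmetric c) (gallai : Gallai c) where

  V = Fin N

  Cross : Fin k → Fin k → Fin k → Set
  Cross i j a = a ≡ i ⊎ a ≡ j

  Cross? : ∀ i j a → Dec (Cross i j a)
  Cross? i j a = (a Fin.≟ i) ⊎-dec (a Fin.≟ j)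

  triangle : ∀ {x y z} → x ≢ y → y ≢ z → x ≢ z → c x y ≡ c y z ⊎ c y z ≡ c x z ⊎ c x y ≡ c x z
  triangle {x} {y} {z} a b d = decidable-stable ((c x y Fin.≟ c y z) ⊎-dec ((c y z Fin.≟ c x z) ⊎-dec (c x y Fin.≟ c x z)))
    λ h → gallai x y z a b d (h ∘ inj₁ , h ∘ inj₂ ∘ inj₁ , h ∘ inj₂ ∘ inj₂)

  Inside : Fin k → Fin k → V → V → Set
  Inside i j x y = x ≢ y × ¬ Cross i j (c x y)

  inside? : ∀ i j x y → Dec (Inside i j x y)
  inside? i j x y = ¬? (x Fin.≟ y) ×-dec ¬? (Cross? i j (c x y))

  inside-sym : ∀ {i j x y} → Inside i j x y → Inside i j y x
  inside-sym {i} {j} (ne , h) = ne ∘ sym , subst (λ a → ¬ Cross i j a) (c-sym _ _ ne) h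

  module Parts (i j : Fin k) (H : List V) (uH : Unique H) where
    open Components (components Fin._≟_ (inside? i j) inside-sym H uH) public

    between : ∀ {x y} → x ∈ˡ H → y ∈ˡ H → label x ≢ label y → Cross i j (c x y)
    between {x} {y} x∈ y∈ ne = decidable-stable (Cross? i j (c x y)) λ h → ne (respects x∈ y∈ ((λ { refl → ne refl }) , h))

    -- Along an edge inside the part the colour towards `z` cannot change: the triangle with `z` has
    -- one side coloured outside {i , j} and two sides coloured inside, so these two agree.
    uniform : ∀ {x y z} → x ∈ˡ H → y ∈ˡ H → z ∈ˡ H → label x ≡ label y → label x ≢ label z → c x z ≡ c y z
    uniform {z = z} x∈ y∈ z∈ e ne = along x∈ (connected x∈ y∈ e) ne
      where
      along : ∀ {x y} → x ∈ˡ H → Conn (Inside i j) H x y → label x ≢ label z → c x z ≡ c y z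
      along x∈ stop ne = refl
      along {x} x∈ (move {y = w} r@(x≢w , h) w∈ p) ne = trans same (along w∈ p ne′)
        where
        ne′ : label w ≢ label z
        ne′ e = ne (trans (respects x∈ w∈ r) e)
        same : c x z ≡ c w z
        same with triangle x≢w (λ { refl → ne′ refl }) (λ { refl → ne refl })
        ... | inj₁ e = ⊥-elim (h (subst (Cross i j) (sym e) (between w∈ z∈ ne′)))
        ... | inj₂ (inj₁ e) = sym e
        ... | inj₂ (inj₂ e) = ⊥-elim (h (subst (Cross i j) (sym e) (between x∈ z∈ ne)))

  record Cut (H : List V) : Set where
    field
      i j : Fin k
      f : V → Bool
      x₀ y₀ : V
      x₀∈ : x₀ ∈ˡ H
      y₀∈ : y₀ ∈ˡ H
      fx₀ : f x₀ ≡ true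
      fy₀ : f y₀ ≡ false
      cross : ∀ {x y} → x ∈ˡ H → y ∈ˡ H → f x ≡ true → f y ≡ false → Cross i j (c x y)

    separates : ∀ (uH : Unique H) → Parts.label i j H uH x₀ ≢ Parts.label i j H uH y₀
    separates uH e = case trans (sym fx₀) (trans (conn-invariant f inv x₀∈ (Parts.connected i j H uH x₀∈ y₀∈ e)) fy₀) of λ ()
      where
      inv : ∀ {a b} → a ∈ˡ H → b ∈ˡ H → Inside i j a b → f a ≡ f b
      inv {a} {b} a∈ b∈ r with f a in ea | f b in eb
      ... | true | true = refl
      ... | false | false = refl
      ... | true | false = ⊥-elim (proj₂ r (cross a∈ b∈ ea eb))
      ... | false | true = ⊥-elim (proj₂ (inside-sym r) (cross b∈ a∈ eb ea))

  module Extend (v : V) (H : List V) (u : Unique (v ∷ H)) where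
    private
      v∉ = head∉ u
      uH : Unique H
      uH = case u of λ { (_ ∷ p) → p }

    star-cut : ∀ {w} i j → w ∈ˡ H → (∀ {x} → x ∈ˡ H → Cross i j (c v x)) → Cut (v ∷ H)
    star-cut {w} i j w∈ h = record
      { i = i ; j = j ; f = λ x → does (x Fin.≟ v) ; x₀ = v ; y₀ = w ; x₀∈ = here refl ; y₀∈ = there w∈
      ; fx₀ = dec-true (v Fin.≟ v) refl ; fy₀ = dec-false (w Fin.≟ v) (λ { refl → v∉ w∈ }) ; cross = cr }
      where
      cr : ∀ {x y} → x ∈ˡ v ∷ H → y ∈ˡ v ∷ H → does (x Fin.≟ v) ≡ true → does (y Fin.≟ v) ≡ false → Cross i j (c x y)
      cr {x} {y} x∈ y∈ ex ey with x Fin.≟ v | y Fin.≟ v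
      cr x∈ (here e) ex ey | yes refl | no ne = ⊥-elim (ne e)
      cr x∈ (there y∈) ex ey | yes refl | no ne = h y∈

    -- The obstruction when no part can be split off: `v` meets every part in one and the same
    -- further colour `g`.
    Touched : Fin k → Fin k → Fin k → Set
    Touched i j g = ¬ Cross i j g × (∀ {w} → w ∈ˡ H → Cross i j (c v w) ⊎ c v w ≡ g)
      × (∀ {w} → w ∈ˡ H → ∃ λ t → t ∈ˡ H × Parts.label i j H uH t ≡ Parts.label i j H uH w × c v t ≡ g)

    -- Vertices of different parts that v meets in colours outside {i , j} span a triangle with v
    -- whose third edge has colour i or j, so v meets both in the same colour.
    extend : ∀ i j x₀ y₀ → x₀ ∈ˡ H → y₀ ∈ˡ H → Parts.label i j H uH x₀ ≢ Parts.label i j H uH y₀ → Cut (v ∷ H) ⊎ ∃ (Touched i j)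
    extend i j x₀ y₀ x₀∈ y₀∈ ne = go (any? free? H)
      where
      open Parts i j H uH
      Free : V → Set
      Free z = ¬ Any (λ t → label t ≡ label z × ¬ Cross i j (c v t)) H
      free? : U.Decidable Free
      free? z = ¬? (any? (λ t → (label t ≟ label z) ×-dec ¬? (Cross? i j (c v t))) H)
      go : Dec (Any Free H) → Cut (v ∷ H) ⊎ ∃ (Touched i j)
      -- A part that `v` meets only in colours `i` and `j` is cut off from all other vertices.
      go (yes w) = let (z , z∈ , fr) = find w in inj₁ (cut z z∈ fr)
        where
        module _ (z : V) (z∈ : z ∈ˡ H) (fr : Free z) where
          in? : U.Decidable (λ x → x ≢ v × label x ≡ label z)
          in? x = ¬? (x Fin.≟ v) ×-dec (label x ≟ label z)
          cr : ∀ {x y} → x ∈ˡ v ∷ H → y ∈ˡ v ∷ H → does (in? x) ≡ true → does (in? y) ≡ false → Cross i j (c x y)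
          cr {x} {y} x∈ y∈ ex ey with does-yes (in? x) ex | does-no (in? y) ey
          cr (here e) _ _ _ | x≢v , _ | _ = ⊥-elim (x≢v e)
          cr {x} (there x∈) (here refl) _ _ | x≢v , e | _ = subst (Cross i j) (c-sym _ _ (x≢v ∘ sym))
            (decidable-stable (Cross? i j (c v x)) λ h → fr (lose x∈ (e , h)))
          cr (there x∈) (there y∈) _ _ | _ , e | n = between x∈ y∈ λ e′ →
            n ((λ { refl → v∉ y∈ }) , trans (sym e′) e)
          cut : Cut (v ∷ H)
          cut = record { i = i ; j = j ; f = λ x → does (in? x) ; x₀ = z ; y₀ = v ; x₀∈ = there z∈ ; y₀∈ = here refl
            ; fx₀ = dec-true (in? z) ((λ { refl → v∉ z∈ }) , refl) ; fy₀ = dec-false (in? v) (λ h → proj₁ h refl) ; cross = cr }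
      go (no ¬free) = inj₂ (g , proj₂ (proj₂ (proj₂ (touch x₀∈))) , cols , λ w∈ →
          let (t , t∈ , e , h) = touch w∈ in t , t∈ , e , other t∈ h)
        where
        touch : ∀ {w} → w ∈ˡ H → ∃ λ t → t ∈ˡ H × label t ≡ label w × ¬ Cross i j (c v t)
        touch {w} w∈ = find (decidable-stable (any? (λ t → (label t ≟ label w) ×-dec ¬? (Cross? i j (c v t))) H) λ h → ¬free (lose w∈ h))
        g : Fin k
        g = c v (proj₁ (touch x₀∈))
        differ : ∀ {s t} → s ∈ˡ H → t ∈ˡ H → ¬ Cross i j (c v s) → ¬ Cross i j (c v t) → label s ≢ label t → c v s ≡ c v t
        differ {s} {t} s∈ t∈ hs ht n with triangle {v} {s} {t} (λ { refl → v∉ s∈ }) (λ { refl → n refl }) (λ { refl → v∉ t∈ })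
        ... | inj₁ e = ⊥-elim (hs (subst (Cross i j) (sym e) (between s∈ t∈ n)))
        ... | inj₂ (inj₁ e) = ⊥-elim (ht (subst (Cross i j) e (between s∈ t∈ n)))
        ... | inj₂ (inj₂ e) = e
        other : ∀ {t} → t ∈ˡ H → ¬ Cross i j (c v t) → c v t ≡ g
        other {t} t∈ h with touch x₀∈ | touch y₀∈
        ... | s , s∈ , es , hs | r , r∈ , er , hr with label t ≟ label s
        ... | no n = differ t∈ s∈ h hs n
        -- `t` and `s` lie in one part, so they are compared through `r`, which lies in another.
        ... | yes e = trans (differ t∈ r∈ h hr λ e′ → ne (trans (sym es) (trans (sym e) (trans e′ er))))
            (differ r∈ s∈ hr hs λ e′ → ne (trans (sym es) (trans (sym e′) er)))
        cols : ∀ {w} → w ∈ˡ H → Cross i j (c v w) ⊎ c v w ≡ g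
        cols {w} w∈ with Cross? i j (c v w)
        ... | yes p = inj₁ p
        ... | no h = inj₂ (other w∈ h)

    -- If v also meets some w in a colour a ∈ {i , j}, then the part of w is joined to the rest of H
    -- in colour a only, and the argument applies again with a alone in place of {i , j}.
    extend-cut : Cut H → Cut (v ∷ H)
    extend-cut C with extend (Cut.i C) (Cut.j C) (Cut.x₀ C) (Cut.y₀ C) (Cut.x₀∈ C) (Cut.y₀∈ C) (Cut.separates C uH)
    ... | inj₁ C′ = C′
    ... | inj₂ (g , g∉ , cols , touch) with any? (λ w → Cross? (Cut.i C) (Cut.j C) (c v w)) H
    ... | no none = star-cut g g (Cut.x₀∈ C) λ w∈ → inj₁ ([ (λ h → ⊥-elim (none (lose w∈ h))) , id ]′ (cols w∈))
    ... | yes some = one-colour (find some)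
      where
      open Cut C using (i; j; x₀; y₀; x₀∈; y₀∈)
      open Parts i j H uH
      one-colour : ∃ (λ w → w ∈ˡ H × Cross i j (c v w)) → Cut (v ∷ H)
      one-colour (w , w∈ , vw) = choose (label w ≟ label x₀)
        where
        a = c v w
        from-w : ∀ {y} → y ∈ˡ H → label w ≢ label y → c w y ≡ a
        from-w {y} y∈ n with touch y∈
        ... | t , t∈ , e , vt = trans (c-sym w y (λ { refl → n refl }))
            (trans (sym (uniform t∈ y∈ w∈ e (λ e′ → n′ (sym e′)))) (trans (c-sym t w (λ { refl → n′ refl })) wt))
          where
          n′ : label w ≢ label t
          n′ e′ = n (trans e′ e)
          -- In the triangle on `v`, `w`, `t` only the side from `v` to `t` is coloured outside {i ,
          -- j}, so the other two sides agree.
          wt : c w t ≡ a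
          wt with triangle {v} {w} {t} (λ { refl → v∉ w∈ }) (λ { refl → n′ refl }) (λ { refl → v∉ t∈ })
          ... | inj₁ p = sym p
          ... | inj₂ (inj₁ p) = ⊥-elim (g∉ (subst (Cross i j) (trans p vt) (between w∈ t∈ n′)))
          ... | inj₂ (inj₂ p) = ⊥-elim (g∉ (subst (Cross i j) (trans p vt) vw))
        in? : U.Decidable (λ x → label x ≡ label w)
        in? x = label x ≟ label w
        cut : ∀ y → y ∈ˡ H → label w ≢ label y → Cut H
        cut y y∈ n = record { i = a ; j = a ; f = λ x → does (in? x) ; x₀ = w ; y₀ = y ; x₀∈ = w∈ ; y₀∈ = y∈
          ; fx₀ = dec-true (in? w) refl ; fy₀ = dec-false (in? y) (n ∘ sym) ; cross = cr }
          where
          cr : ∀ {x y} → x ∈ˡ H → y ∈ˡ H → does (in? x) ≡ true → does (in? y) ≡ false → Cross a a (c x y)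
          cr {x} {y} x∈ y∈ ex ey with does-yes (in? x) ex | does-no (in? y) ey
          ... | e | n = inj₁ (trans (sym (uniform w∈ x∈ y∈ (sym e) (n ∘ sym))) (from-w y∈ (n ∘ sym)))
        finish : Cut (v ∷ H) ⊎ ∃ (Touched a a) → Cut (v ∷ H)
        finish (inj₁ C′) = C′
        -- Only the colours `a` and `g′` remain at `v`, so `v` alone is one side of a cut.
        finish (inj₂ (g′ , _ , cols′ , _)) = star-cut a g′ w∈ λ x∈ → [ [ inj₁ , inj₁ ]′ , inj₂ ]′ (cols′ x∈)
        via : ∀ y → y ∈ˡ H → label w ≢ label y → Cut (v ∷ H)
        via y y∈ n = finish (extend a a w y w∈ y∈ (Cut.separates (cut y y∈ n) uH))
        choose : Dec (label w ≡ label x₀) → Cut (v ∷ H)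
        choose (no n) = via x₀ x₀∈ n
        choose (yes e) = via y₀ y₀∈ λ e′ → Cut.separates C uH (trans (sym e) e′)

  gallai-cut : ∀ H → Unique H → 2 ≤ length H → Cut H
  gallai-cut (v ∷ w ∷ []) u _ = Extend.star-cut v (w ∷ []) u (c v w) (c v w) (here refl) λ { (here refl) → inj₁ refl }
  gallai-cut (v ∷ w ∷ x ∷ H) u@(_ ∷ u′) _ = Extend.extend-cut v (w ∷ x ∷ H) u (gallai-cut (w ∷ x ∷ H) u′ (s≤s (s≤s z≤n)))
  gallai-cut [] _ ()
  gallai-cut (_ ∷ []) _ (s≤s ())

-- Minimal modules with at least n vertices.

module Descent {N k : ℕ} (c : Coloring N k) (c-sym : Symmetric c) (gallai : Gallai c) (n : ℕ) (2≤n : 2 ≤ n) where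
  open GallaiCut c c-sym gallai

  Module : List V → Set
  Module H = ∀ {v x y} → v ∉ H → x ∈ˡ H → y ∈ˡ H → c v x ≡ c v y

  SmallParts : Fin k → Fin k → ∀ H → Unique H → Set
  SmallParts i j H u = ∀ a → length (filter (λ x → Parts.label i j H u x ≟ a) H) < n

  record TwoColour (H : List V) (u : Unique H) : Set where
    field
      i j : Fin k
      i≢j : i ≢ j
      spans-i : ∀ {x y} → x ∈ˡ H → y ∈ˡ H → Reach c i x y
      spans-j : ∀ {x y} → x ∈ˡ H → y ∈ˡ H → Reach c j x y
      small : SmallParts i j H u

  record Outcome : Set where
    field
      H : List V
      unique : Unique H
      isModule : Module H
      size : n ≤ length H
      shape : TwoColour H unique ⊎ ∃ λ j → SmallParts j j H unique

  reach-trans : ∀ {i x y z} → Reach c i x y → Reach c i y z → Reach c i x z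
  reach-trans Reach.here q = q
  reach-trans (step ne e p) q = step ne e (reach-trans p q)

  module _ (H : List V) (u : Unique H) (mod : Module H) where

    record SmallerModule : Set where
      field
        H′ : List V
        unique′ : Unique H′
        module′ : Module H′
        size′ : n ≤ length H′
        smaller : length H′ < length H

    -- A part with at least `n` vertices is itself a module: vertices outside `H` see it in one
    -- colour because `H` is a module, the others by `uniform`. It is proper since `x₀` and `y₀` lie
    -- in different parts.
    big-part : ∀ i j x₀ y₀ → x₀ ∈ˡ H → y₀ ∈ˡ H → Parts.label i j H u x₀ ≢ Parts.label i j H u y₀ → SmallerModule ⊎ SmallParts i j H u
    big-part i j x₀ y₀ x₀∈ y₀∈ ne = go (any? (λ z → n ≤? length (part (label z))) H)
      where
      open Parts i j H u
      part : ℕ → List V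
      part a = filter (λ x → label x ≟ a) H
      go : Dec (Any (λ z → n ≤ length (part (label z))) H) → SmallerModule ⊎ SmallParts i j H u
      go (no none) = inj₂ small
        where
        small : SmallParts i j H u
        small a with part a in eq
        ... | [] = ≤-trans (s≤s z≤n) 2≤n
        ... | z ∷ zs with ∈-filter⁻ (λ x → label x ≟ a) {xs = H} (subst (z ∈ˡ_) (sym eq) (here refl))
        ... | z∈ , refl = ≰⇒> λ le → none (lose z∈ (subst (λ t → n ≤ length t) (sym eq) le))
      go (yes w) = let (z , z∈ , le) = find w in inj₁ (smaller-module z z∈ le)
        where
        module _ (z : V) (z∈ : z ∈ˡ H) (le : n ≤ length (part (label z))) where
          members : ∀ {x} → x ∈ˡ part (label z) → x ∈ˡ H × label x ≡ label z
          members = ∈-filter⁻ (λ x → label x ≟ label z) {xs = H}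
          elsewhere : ∃ λ y → y ∈ˡ H × label y ≢ label z
          elsewhere with label x₀ ≟ label z
          ... | no m = x₀ , x₀∈ , m
          ... | yes e = y₀ , y₀∈ , λ e′ → ne (trans e (sym e′))
          part-module : Module (part (label z))
          part-module {v} {x} {y} v∉ x∈ y∈ with v ∈? H
          ... | no v∉H = mod v∉H (proj₁ (members x∈)) (proj₁ (members y∈))
          ... | yes v∈H = trans (c-sym v x (λ { refl → v∉ x∈ })) (trans (uniform (proj₁ (members x∈)) (proj₁ (members y∈)) v∈H
              (trans (proj₂ (members x∈)) (sym (proj₂ (members y∈)))) λ e →
                v∉ (∈-filter⁺ (λ x → label x ≟ label z) v∈H (trans (sym e) (proj₂ (members x∈)))))
              (c-sym y v (λ { refl → v∉ y∈ })))
          smaller-module : SmallerModule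
          smaller-module = let (y , y∈ , m) = elsewhere in record
            { H′ = part (label z) ; unique′ = Uniq.filter⁺ (λ x → label x ≟ label z) u ; module′ = part-module ; size′ = le
            ; smaller = unique-⊆-length (Unique-∷ (m ∘ proj₂ ∘ members) (Uniq.filter⁺ (λ x → label x ≟ label z) u))
                (λ { (here refl) → y∈ ; (there p) → proj₁ (members p) }) }

    -- If the colours other than j connect H, then so does colour i alone, since
    -- vertices in one part have a common neighbour in colour i.
    spans : ∀ i j x₀ y₀ → x₀ ∈ˡ H → y₀ ∈ˡ H → Parts.label i j H u x₀ ≢ Parts.label i j H u y₀ →
      (∀ {x y} → x ∈ˡ H → y ∈ˡ H → Conn (Inside j j) H x y) → ∀ {x y} → x ∈ˡ H → y ∈ˡ H → Reach c i x y
    spans i j x₀ y₀ x₀∈ y₀∈ ne conn x∈ y∈ = walk x∈ (conn x∈ y∈)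
      where
      open Parts i j H u
      crossing-i : ∀ {a b} → a ∈ˡ H → b ∈ˡ H → Inside j j a b → label a ≢ label b → c a b ≡ i
      crossing-i a∈ b∈ (_ , h) m = [ id , (λ e → ⊥-elim (h (inj₁ e))) ]′ (between a∈ b∈ m)
      -- The walk avoiding `j` is followed to its first step out of the part of `x`. This step has
      -- colour `i`, and `uniform` carries its start back to `x`.
      leave : ∀ {x z} → x ∈ˡ H → Conn (Inside j j) H x z → label x ≢ label z →
        ∃ λ w → w ∈ˡ H × label x ≢ label w × c x w ≡ i
      leave x∈ stop m = ⊥-elim (m refl)
      leave {x} x∈ (move {y = y} r y∈ p) m with label x ≟ label y
      ... | no m′ = y , y∈ , m′ , crossing-i x∈ y∈ r m′
      ... | yes e with leave y∈ p (λ e′ → m (trans e e′))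
      ... | w , w∈ , m′ , cyw = w , w∈ , (λ e′ → m′ (trans (sym e) e′)) , trans (uniform x∈ y∈ w∈ e (λ e′ → m′ (trans (sym e) e′))) cyw
      exit : ∀ {x} → x ∈ˡ H → ∃ λ w → w ∈ˡ H × label x ≢ label w × c x w ≡ i
      exit {x} x∈ with label x ≟ label x₀
      ... | no m = leave x∈ (conn x∈ x₀∈) m
      ... | yes e = leave x∈ (conn x∈ y₀∈) λ e′ → ne (trans (sym e) e′)
      hop : ∀ {x y} → x ∈ˡ H → y ∈ˡ H → Inside j j x y → Reach c i x y
      hop {x} {y} x∈ y∈ r with label x ≟ label y
      ... | no m = step (proj₁ r) (crossing-i x∈ y∈ r m) Reach.here
      ... | yes e with exit x∈
      ... | w , w∈ , m , cxw = step (λ { refl → m refl }) cxw (step (λ { refl → m e })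
            (trans (c-sym w y (λ { refl → m e })) (trans (sym (uniform x∈ y∈ w∈ e m)) cxw)) Reach.here)
      walk : ∀ {x y} → x ∈ˡ H → Conn (Inside j j) H x y → Reach c i x y
      walk x∈ stop = Reach.here
      walk x∈ (move r y∈ p) = reach-trans (hop x∈ y∈ r) (walk y∈ p)

    connected-or : ∀ j {x₀} → x₀ ∈ˡ H →
      (∃ λ z → z ∈ˡ H × Parts.label j j H u x₀ ≢ Parts.label j j H u z) ⊎ (∀ {x y} → x ∈ˡ H → y ∈ˡ H → Conn (Inside j j) H x y)
    connected-or j {x₀} x₀∈ with any? (λ z → ¬? (Parts.label j j H u x₀ ≟ Parts.label j j H u z)) H
    ... | yes w = inj₁ (find w)
    ... | no none = inj₂ λ x∈ y∈ → connected x∈ y∈ (trans (sym (same x∈)) (same y∈))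
      where
      open Parts j j H u
      same : ∀ {x} → x ∈ˡ H → label x₀ ≡ label x
      same {x} x∈ = decidable-stable (label x₀ ≟ label x) λ m → none (lose x∈ m)

    -- If the edges not coloured `j` fail to connect `H`, parts are taken for `j` alone, and
    -- likewise for `i`. If both connect `H`, then `spans` shows that each of the two colours does.
    refine : n ≤ length H → SmallerModule ⊎ (TwoColour H u ⊎ ∃ λ j → SmallParts j j H u)
    refine n≤ with gallai-cut H u (≤-trans 2≤n n≤)
    ... | C with Cut.i C | Cut.j C | Cut.separates C u
        | big-part (Cut.i C) (Cut.j C) (Cut.x₀ C) (Cut.y₀ C) (Cut.x₀∈ C) (Cut.y₀∈ C) (Cut.separates C u)
    ... | _ | _ | _ | inj₁ s = inj₁ s
    ... | i | j | sep | inj₂ small with connected-or j (Cut.x₀∈ C) | connected-or i (Cut.x₀∈ C)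
    ... | inj₁ (z , z∈ , m) | _ = [ inj₁ , (λ s → inj₂ (inj₂ (j , s))) ]′ (big-part j j _ z (Cut.x₀∈ C) z∈ m)
    ... | inj₂ _ | inj₁ (z , z∈ , m) = [ inj₁ , (λ s → inj₂ (inj₂ (i , s))) ]′ (big-part i i _ z (Cut.x₀∈ C) z∈ m)
    ... | inj₂ cj | inj₂ ci = inj₂ (inj₁ (record
        { i = i ; j = j ; i≢j = distinct ; small = small
        ; spans-i = spans i j x₀ y₀ x₀∈ y₀∈ sep cj
        ; spans-j = spans-swap }))
      where
      open Cut C using (x₀; y₀; x₀∈; y₀∈)
      swap-inside : ∀ {a b} → Inside j i a b → Inside i j a b
      swap-inside (d , h) = d , λ { (inj₁ e) → h (inj₂ e) ; (inj₂ e) → h (inj₁ e) }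
      sep′ : Parts.label j i H u x₀ ≢ Parts.label j i H u y₀
      sep′ e = sep (conn-invariant (Parts.label i j H u) (λ a∈ b∈ r → Parts.respects i j H u a∈ b∈ (swap-inside r)) x₀∈
        (Parts.connected j i H u x₀∈ y₀∈ e))
      spans-swap : ∀ {x y} → x ∈ˡ H → y ∈ˡ H → Reach c j x y
      spans-swap = spans j i x₀ y₀ x₀∈ y₀∈ sep′ ci
      distinct : i ≢ j
      distinct e = sep (conn-invariant (Parts.label i j H u) (λ a∈ b∈ r → Parts.respects i j H u a∈ b∈
        (proj₁ r , λ { (inj₁ p) → proj₂ r (inj₁ (trans p e)) ; (inj₂ p) → proj₂ r (inj₁ p) })) x₀∈ (cj x₀∈ y₀∈))

  descend : ∀ fuel H → length H ≤ fuel → (u : Unique H) → Module H → n ≤ length H → Outcome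
  descend zero H le u mod n≤ = case ≤-trans 2≤n (≤-trans n≤ le) of λ ()
  descend (suc fuel) H le u mod n≤ with refine H u mod n≤
  ... | inj₂ s = record { H = H ; unique = u ; isModule = mod ; size = n≤ ; shape = s }
  ... | inj₁ S = descend fuel H′ (≤-pred (≤-trans smaller le)) unique′ module′ size′
    where open SmallerModule S

-- Cycles as indexed families, and counting vertices by colour.

lookup-injective : ∀ {A : Set} {xs : List A} → Unique xs → ∀ {i j} → lookup xs i ≡ lookup xs j → i ≡ j
lookup-injective (_ ∷ _) {zero} {zero} _ = refl
lookup-injective {xs = x ∷ xs} (p ∷ _) {zero} {suc j} e = ⊥-elim (All.lookup p (∈-lookup {xs = xs} j) e)
lookup-injective {xs = x ∷ xs} (p ∷ _) {suc i} {zero} e = ⊥-elim (All.lookup p (∈-lookup {xs = xs} i) (sym e))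
lookup-injective (_ ∷ u) {suc i} {suc j} e = cong suc (lookup-injective u e)

walk-next : ∀ {A : Set} {R : A → A → Set} x ys {z} → Walk R x ys z → ∀ i j → suc (toℕ i) ≡ toℕ j →
  R (lookup (x ∷ ys) i) (lookup (x ∷ ys) j)
walk-next x (y ∷ ys) (r , w) zero (suc zero) refl = r
walk-next x (y ∷ ys) (r , w) (suc i) (suc j) e = walk-next y ys w i j (suc-injective e)

walk-close : ∀ {A : Set} {R : A → A → Set} x ys {z} → Walk R x ys z → ∀ i → suc (toℕ i) ≡ suc (length ys) → R (lookup (x ∷ ys) i) z
walk-close x [] r zero _ = r
walk-close x (y ∷ ys) (r , w) (suc i) e = walk-close y ys w i (suc-injective e)

cycle-map : ∀ {A B : Set} {R : A → A → Set} {S : B → B → Set} {L} (f : A → B) → (∀ {x y} → f x ≡ f y → x ≡ y) →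
  (∀ {x y} → R x y → S (f x) (f y)) → Cycle R L → Cycle S L
cycle-map {R = R} {S} f inj h (mkCycle x ys len u w) =
  mkCycle (f x) (map f ys) (trans (cong suc (length-map f ys)) len) (Uniq.map⁺ inj u) (go x ys w)
  where
  go : ∀ x ys {z} → Walk R x ys z → Walk S (f x) (map f ys) (f z)
  go x [] r = h r
  go x (y ∷ ys) (r , w) = h r , go y ys w

fibres : ∀ {A : Set} {k} (g : A → Fin k) p (ls : List (Fin k)) (xs : List A) → (∀ {x} → x ∈ˡ xs → g x ∈ˡ ls) →
  (∀ l → length (filter (λ x → g x Fin.≟ l) xs) ≤ p) → length xs ≤ length ls * p
fibres g p [] [] _ _ = z≤n
fibres g p [] (x ∷ xs) h _ = case h (here refl) of λ ()
fibres g p (l ∷ ls) xs h b = ≤-trans (≤-reflexive (sym (filter-++¬ (λ x → g x Fin.≟ l) xs)))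
  (+-mono-≤ (b l) (fibres g p ls rest h′ λ l′ → ≤-trans (sub l′ xs) (b l′)))
  where
  other? = λ x → ¬? (g x Fin.≟ l)
  rest = filter other? xs
  h′ : ∀ {x} → x ∈ˡ rest → g x ∈ˡ ls
  h′ x∈ with ∈-filter⁻ other? {xs = xs} x∈
  ... | x∈xs , n with h x∈xs
  ... | here e = ⊥-elim (n e)
  ... | there q = q
  sub : ∀ l′ ys → length (filter (λ x → g x Fin.≟ l′) (filter other? ys)) ≤ length (filter (λ x → g x Fin.≟ l′) ys)
  sub l′ [] = z≤n
  sub l′ (y ∷ ys) with g y Fin.≟ l
  ... | yes _ = ≤-trans (sub l′ ys) (count-tail (λ x → g x Fin.≟ l′) y ys)
  ... | no _ with g y Fin.≟ l′
  ... | yes _ = s≤s (sub l′ ys)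
  ... | no _ = sub l′ ys

elements : ∀ {k} → Subset k → List (Fin k)
elements Vec.[] = []
elements (inside Vec.∷ Q) = zero ∷ map suc (elements Q)
elements (outside Vec.∷ Q) = map suc (elements Q)

length-elements : ∀ {k} (Q : Subset k) → length (elements Q) ≡ ∣ Q ∣
length-elements Vec.[] = refl
length-elements (inside Vec.∷ Q) = cong suc (trans (length-map suc (elements Q)) (length-elements Q))
length-elements (outside Vec.∷ Q) = trans (length-map suc (elements Q)) (length-elements Q)

∈-elements : ∀ {k} (Q : Subset k) {l} → l ∈ Q → l ∈ˡ elements Q
∈-elements (inside Vec.∷ Q) Vec.here = here refl
∈-elements (inside Vec.∷ Q) (Vec.there p) = there (∈-map⁺ suc (∈-elements Q p))
∈-elements (outside Vec.∷ Q) (Vec.there p) = ∈-map⁺ suc (∈-elements Q p)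

unique-elements : ∀ {k} (Q : Subset k) → Unique (elements Q)
unique-elements Vec.[] = []
unique-elements (inside Vec.∷ Q) = Unique-∷ (λ p → case ∈-map⁻ suc p of λ { (_ , _ , ()) }) (Uniq.map⁺ Fin.suc-injective (unique-elements Q))
unique-elements (outside Vec.∷ Q) = Uniq.map⁺ Fin.suc-injective (unique-elements Q)

-- The minimal module and the vertices attached to it.

module Main {N k : ℕ} (c : Coloring N k) (c-sym : Symmetric c) (gallai : Gallai c) (p : ℕ) (2≤p : 2 ≤ p)
  (Q : Subset k) (big∈Q : ∀ {l} → HasBigComponent c (suc p) l → l ∈ Q) (large : p * ∣ Q ∣ + 2 * suc p + 2 ≤ N) where
  open GallaiCut c c-sym gallai
  open Descent c c-sym gallai (suc p) (≤-trans 2≤p (n≤1+n p))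

  n : ℕ
  n = suc p

  Mono : Fin k → V → V → Set
  Mono a x y = x ≢ y × c x y ≡ a

  mono-sym : ∀ {a x y} → Mono a x y → Mono a y x
  mono-sym (ne , e) = ne ∘ sym , trans (c-sym _ _ (ne ∘ sym)) e

  Goal : Set
  Goal = ∃ λ a → Cycle (Mono a) (2 * n)

  all = allFin N
  unique-all : Unique all
  unique-all = Uniq.allFin⁺ N

  module _ (H : List V) (uH : Unique H) (mod : Module H) (size : n ≤ length H) (h₀ : V) (h₀∈ : h₀ ∈ˡ H) where

    private
      embed : Fin n → V
      embed t = lookup H (inject≤ t size)

      embed-∈ : ∀ t → embed t ∈ˡ H
      embed-∈ t = ∈-lookup {xs = H} (inject≤ t size)

      reached : ∀ {l} v → (∀ {x} → x ∈ˡ H → Reach c l v x) → l ∈ Q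
      reached v r = big∈Q (v , embed , (λ e → Fin.inject≤-injective size size _ _ (lookup-injective uH e)) , λ t → r (embed-∈ t))

      -- As `H` is a module, the colour towards `h₀` is the colour towards all of `H`.
      attached? : ∀ l v → Dec (v ∉ H × c v h₀ ≡ l)
      attached? l v = ¬? (v ∈? H) ×-dec (c v h₀ Fin.≟ l)

      attached : Fin k → List V
      attached l = filter (attached? l) all

      attached-∈Q : ∀ {v} → v ∉ H → c v h₀ ∈ Q
      attached-∈Q {v} v∉ = reached v λ x∈ → step (λ { refl → v∉ x∈ }) (mod v∉ x∈ h₀∈) Reach.here

      -- More than `p` vertices attached in one colour form, with `H`, a monochromatic complete
      -- bipartite graph with at least `n` vertices on each side.
      few-attached : (∀ l → length (attached l) ≤ p) ⊎ Goal
      few-attached = all-or λ l → go l (length (attached l) ≤? p)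
        where
        go : ∀ l → Dec (length (attached l) ≤ p) → length (attached l) ≤ p ⊎ Goal
        go l (yes le) = inj₁ le
        go l (no ¬le) = inj₂ (l , bip mono-sym proj₁ p (attached l) H (≰⇒> ¬le) size (Uniq.filter⁺ (attached? l) unique-all) uH
          λ x∈ y∈ → let (x∉ , e) = proj₂ (∈-filter⁻ (attached? l) {xs = all} x∈)
                    in (λ { refl → x∉ y∈ }) , trans (mod x∉ y∈ h₀∈) e)

    module _ (few : ∀ l → length (attached l) ≤ p) where

      private
        few-outside : ∀ {P : V → Set} (P? : U.Decidable P) (ls : List (Fin k)) →
          (∀ {v} → P v → v ∉ H) → (∀ {v} → P v → c v h₀ ∈ˡ ls) → length (filter P? all) ≤ length ls * p
        few-outside P? ls out cl = fibres (λ v → c v h₀) p ls (filter P? all) (cl ∘ filter-holds P? {all})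
          λ l → ≤-trans (filter-mono (λ v → c v h₀ Fin.≟ l) (attached? l) (filter P? all) all (Uniq.filter⁺ P? unique-all)
            λ {x} x∈ e → ∈-allFin x , out (filter-holds P? {all} x∈) , e) (few l)

      -- All colours towards `H` lie in `Q`, so at most `p * ∣ Q ∣` vertices are outside and at
      -- least `2 * n` remain in `H`.
      one-colour : ∀ j → SmallParts j j H uH → Goal
      one-colour j small = j , multipartite-cycle label mono-sym p H uH H-big (λ a → ≤-pred (small a))
          λ x∈ y∈ ne → (λ { refl → ne refl }) , [ id , id ]′ (between x∈ y∈ ne)
        where
        open Parts j j H uH
        H-big : 2 * suc p ≤ length H
        H-big = +-cancelʳ-≤ (∣ Q ∣ * p) _ _ (begin
          2 * suc p + ∣ Q ∣ * p ≡⟨ cong (2 * suc p +_) (*-comm ∣ Q ∣ p) ⟩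
          2 * suc p + p * ∣ Q ∣ ≡⟨ +-comm (2 * suc p) _ ⟩
          p * ∣ Q ∣ + 2 * suc p ≤⟨ m≤m+n _ 2 ⟩
          p * ∣ Q ∣ + 2 * suc p + 2 ≤⟨ large ⟩
          N ≡⟨ sym (trans (filter-++¬ (_∈? H) all) (length-tabulate id)) ⟩
          length (filter (_∈? H) all) + length (filter (¬? ∘ (_∈? H)) all) ≤⟨ +-mono-≤
            (unique-⊆-length (Uniq.filter⁺ (_∈? H) unique-all) (filter-holds (_∈? H) {all}))
            (≤-trans (few-outside (¬? ∘ (_∈? H)) (elements Q) id (λ v∉ → ∈-elements Q (attached-∈Q v∉)))
              (≤-reflexive (cong (_* p) (length-elements Q)))) ⟩
          length H + ∣ Q ∣ * p ∎)
          where open ≤-Reasoning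

      module _ (T : TwoColour H uH) where
        open TwoColour T

        private
          In : V → Set
          In v = v ∈ˡ H ⊎ Cross i j (c v h₀)

          in? : U.Decidable In
          in? v = (v ∈? H) ⊎-dec Cross? i j (c v h₀)

          X : List V
          X = filter in? all

          uX : Unique X
          uX = Uniq.filter⁺ in? unique-all

          others : List (Fin k)
          others = filter (λ l → ¬? (Cross? i j l)) (elements Q)

          -- Both `i` and `j` span `H`, so they are two distinct members of `Q`.
          others-few : 2 + length others ≤ ∣ Q ∣
          others-few = ≤-trans (unique-⊆-length {xs = i ∷ j ∷ others}
              (Unique-∷ (λ { (here e) → i≢j e ; (there q) → filter-holds (λ l → ¬? (Cross? i j l)) {elements Q} q (inj₁ refl) })
                (Unique-∷ (λ q → filter-holds (λ l → ¬? (Cross? i j l)) {elements Q} q (inj₂ refl))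
                  (Uniq.filter⁺ (λ l → ¬? (Cross? i j l)) (unique-elements Q))))
              (λ { (here refl) → ∈-elements Q (reached h₀ (spans-i h₀∈)) ; (there (here refl)) → ∈-elements Q (reached h₀ (spans-j h₀∈))
                 ; (there (there q)) → filter-⊆ (λ l → ¬? (Cross? i j l)) {elements Q} q }))
            (≤-reflexive (length-elements Q))

          -- At most `∣ Q ∣ - 2` colours attach vertices outside `X`, which leaves
          -- `2 * p + 2 * n + 2 = 4 * n` vertices.
          X-big : 4 * n ≤ length X
          X-big = +-cancelʳ-≤ (length others * p) _ _ (begin
            4 * suc p + length others * p ≡⟨ lem p (length others) ⟩
            p * (2 + length others) + 2 * suc p + 2 ≤⟨ +-monoˡ-≤ 2 (+-monoˡ-≤ (2 * suc p) (*-monoʳ-≤ p others-few)) ⟩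
            p * ∣ Q ∣ + 2 * suc p + 2 ≤⟨ large ⟩
            N ≡⟨ sym (trans (filter-++¬ in? all) (length-tabulate id)) ⟩
            length X + length (filter (¬? ∘ in?) all) ≤⟨ +-monoʳ-≤ (length X) (few-outside (¬? ∘ in?) others (_∘ inj₁)
              λ h → ∈-filter⁺ (λ l → ¬? (Cross? i j l)) (∈-elements Q (attached-∈Q (h ∘ inj₁))) (h ∘ inj₂)) ⟩
            length X + length others * p ∎)
            where
            open ≤-Reasoning
            lem : ∀ p o → 4 * suc p + o * p ≡ p * (2 + o) + 2 * suc p + 2
            lem = solve-∀

          module PX = Parts i j X uX
          module PH = Parts i j H uH

          -- The parts of X lie inside H, or among the vertices attached in one colour.
          place : V → ℕ
          place v with v ∈? H | c v h₀ Fin.≟ i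
          ... | yes _ | _ = suc (suc (PH.label v))
          ... | no _ | yes _ = 0
          ... | no _ | no _ = 1

          no-exit : ∀ {a b} → a ∈ˡ H → b ∉ H → In b → ¬ Inside i j b a
          no-exit a∈ b∉ (inj₁ b∈) _ = b∉ b∈
          no-exit a∈ b∉ (inj₂ cr) (_ , h) = h (subst (Cross i j) (sym (mod b∉ a∈ h₀∈)) cr)

          -- The triangle on `a`, `b`, `h₀` has sides of the distinct colours `i` and `j`, so its
          -- third side has one of these.
          no-mix : ∀ {a b} → a ∉ H → b ∉ H → c a h₀ ≡ i → c b h₀ ≡ j → ¬ Inside i j a b
          no-mix {a} {b} a∉ b∉ ea eb (ne , h) with triangle ne (λ { refl → b∉ h₀∈ }) (λ { refl → a∉ h₀∈ })
          ... | inj₁ e = h (inj₂ (trans e eb))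
          ... | inj₂ (inj₁ e) = i≢j (trans (sym ea) (trans (sym e) eb))
          ... | inj₂ (inj₂ e) = h (inj₁ (trans e ea))

          j-attached : ∀ {v} → In v → v ∉ H → c v h₀ ≢ i → c v h₀ ≡ j
          j-attached (inj₁ v∈) v∉ _ = ⊥-elim (v∉ v∈)
          j-attached (inj₂ (inj₁ e)) _ ne = ⊥-elim (ne e)
          j-attached (inj₂ (inj₂ e)) _ _ = e

          place-inv : ∀ {a b} → a ∈ˡ X → b ∈ˡ X → Inside i j a b → place a ≡ place b
          place-inv {a} {b} a∈ b∈ r with a ∈? H | b ∈? H | c a h₀ Fin.≟ i | c b h₀ Fin.≟ i
          ... | yes a∈H | yes b∈H | _ | _ = cong (λ t → suc (suc t)) (PH.respects a∈H b∈H r)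
          ... | yes a∈H | no b∉ | _ | _ = ⊥-elim (no-exit a∈H b∉ (filter-holds in? {all} b∈) (inside-sym r))
          ... | no a∉ | yes b∈H | _ | _ = ⊥-elim (no-exit b∈H a∉ (filter-holds in? {all} a∈) r)
          ... | no _ | no _ | yes _ | yes _ = refl
          ... | no _ | no _ | no _ | no _ = refl
          ... | no a∉ | no b∉ | yes ea | no nb = ⊥-elim (no-mix a∉ b∉ ea (j-attached (filter-holds in? {all} b∈) b∉ nb) r)
          ... | no a∉ | no b∉ | no na | yes eb = ⊥-elim (no-mix b∉ a∉ eb (j-attached (filter-holds in? {all} a∈) a∉ na) (inside-sym r))

          place-small : ∀ t → length (filter (λ v → place v ≟ t) X) ≤ p
          place-small zero = ≤-trans (filter-mono (λ v → place v ≟ 0) (attached? i) X all uX f) (few i)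
            where
            f : ∀ {x} → x ∈ˡ X → place x ≡ 0 → x ∈ˡ all × x ∉ H × c x h₀ ≡ i
            f {x} x∈ e with x ∈? H | c x h₀ Fin.≟ i
            f {x} x∈ e | no x∉ | yes ex = ∈-allFin x , x∉ , ex
          place-small (suc zero) = ≤-trans (filter-mono (λ v → place v ≟ 1) (attached? j) X all uX f) (few j)
            where
            f : ∀ {x} → x ∈ˡ X → place x ≡ 1 → x ∈ˡ all × x ∉ H × c x h₀ ≡ j
            f {x} x∈ e with x ∈? H | c x h₀ Fin.≟ i
            f {x} x∈ e | no x∉ | no nx = ∈-allFin x , x∉ , j-attached (filter-holds in? {all} x∈) x∉ nx
          place-small (suc (suc t)) = ≤-trans (filter-mono (λ v → place v ≟ suc (suc t)) (λ v → PH.label v ≟ t) X H uX f) (≤-pred (small t))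
            where
            f : ∀ {x} → x ∈ˡ X → place x ≡ suc (suc t) → x ∈ˡ H × PH.label x ≡ t
            f {x} x∈ e with x ∈? H | c x h₀ Fin.≟ i
            f {x} x∈ e | yes x∈H | _ = x∈H , suc-injective (suc-injective e)
            f {x} x∈ () | no _ | yes _
            f {x} x∈ () | no _ | no _

          -- `place` is constant on each part of `X`, so a part lies in a single fibre of `place`.
          X-small : ∀ a → length (filter (λ v → PX.label v ≟ a) X) ≤ p
          X-small a with filter (λ v → PX.label v ≟ a) X in eq
          ... | [] = z≤n
          ... | x ∷ xs with ∈-filter⁻ (λ v → PX.label v ≟ a) {xs = X} (subst (x ∈ˡ_) (sym eq) (here refl))
          ... | x∈ , refl = subst (λ t → length t ≤ p) eq (≤-trans (filter-mono (λ v → PX.label v ≟ PX.label x) (λ v → place v ≟ place x) X X uX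
              λ y∈ e → y∈ , conn-invariant place place-inv y∈ (PX.connected y∈ x∈ e)) (place-small (place x)))

          colour : Bool → Fin k
          colour true = i
          colour false = j

          at : Fin (length X) → V
          at = lookup X

          at-∈ : ∀ t → at t ∈ˡ X
          at-∈ = ∈-lookup {xs = X}

          -- Vertices are positions in `X`. Pairs inside a part count as non-adjacent whatever their
          -- colour.
          twin : TwinColouring (length X)
          twin = record
            { E = λ b x y → PX.label (at x) ≢ PX.label (at y) × c (at x) (at y) ≡ colour b
            ; E? = λ b x y → ¬? (PX.label (at x) ≟ PX.label (at y)) ×-dec (c (at x) (at y) Fin.≟ colour b)
            ; label = PX.label ∘ at
            ; E-sym = λ (ne , e) → ne ∘ sym , trans (c-sym _ _ (λ q → ne (cong PX.label (sym q)))) e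
            ; E-or = λ {x} {y} ne → [ (λ e → inj₁ (ne , e)) , (λ e → inj₂ (ne , e)) ]′ (PX.between (at-∈ x) (at-∈ y) ne)
            ; E-twin = λ {b} {x} {y} {z} tw (ne , e) → (λ q → ne (trans tw q)) , trans (sym (PX.uniform (at-∈ x) (at-∈ y) (at-∈ z) tw ne)) e
            ; E-irr = proj₁ }

          twin-small : ClassesAtMost (PX.label ∘ at) n (allFin (length X))
          twin-small a = ≤-trans (≤-trans (≤-reflexive (sym (length-map at (filter (λ t → PX.label (at t) ≟ a) (allFin (length X))))))
              (unique-⊆-length
              (Uniq.map⁺ (lookup-injective uX) (Uniq.filter⁺ (λ t → PX.label (at t) ≟ a) (Uniq.allFin⁺ (length X))))
              sub)) (≤-trans (X-small a) (n≤1+n p))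
            where
            sub : ∀ {v} → v ∈ˡ map at (filter (λ t → PX.label (at t) ≟ a) (allFin (length X))) → v ∈ˡ filter (λ v → PX.label v ≟ a) X
            sub v∈ with ∈-map⁻ at v∈
            ... | t , t∈ , refl = ∈-filter⁺ (λ v → PX.label v ≟ a) (at-∈ t)
              (filter-holds (λ t → PX.label (at t) ≟ a) {allFin (length X)} t∈)

        two-colour : Goal
        two-colour = finish p refl
          where
          finish : ∀ q → q ≡ p → Goal
          finish zero refl = case 2≤p of λ ()
          -- Here `n = q + 2`, so the length `2 * (q + 2)` is `2 * n`.
          finish (suc q) refl with Core.even-cycle twin n X-big twin-small (s≤s 2≤p) q ≤-refl
          ... | b , C = colour b , cycle-map at (lookup-injective uX) (λ (ne , e) → (λ q → ne (cong PX.label q)) , e) C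

    module-cycle : TwoColour H uH ⊎ (∃ λ j → SmallParts j j H uH) → Goal
    module-cycle s with few-attached
    ... | inj₂ g = g
    ... | inj₁ few = [ two-colour few , (λ (j , sm) → one-colour few j sm) ]′ s

  goal : n ≤ N → Goal
  -- The descent starts from the whole vertex set, which is vacuously a module.
  goal n≤N with descend N all (≤-reflexive (length-tabulate id)) unique-all (λ {v} v∉ _ _ → ⊥-elim (v∉ (∈-allFin v)))
      (≤-trans n≤N (≤-reflexive (sym (length-tabulate id))))
  ... | O = start (Outcome.H O) refl
    where
    start : ∀ hs → hs ≡ Outcome.H O → Goal
    start [] e = case subst (λ t → n ≤ length t) (sym e) (Outcome.size O) of λ ()
    start (h ∷ _) e = module-cycle (Outcome.H O) (Outcome.unique O) (Outcome.isModule O) (Outcome.size O) h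
      (subst (h ∈ˡ_) e (here refl)) (Outcome.shape O)

  mono-cycle : Goal → MonoCycle c (2 * n)
  mono-cycle (a , mkCycle x ys len u w) = subst (MonoCycle c) len (a , lookup (x ∷ ys) , lookup-injective u , λ
    { t t′ (inj₁ e) → proj₂ (walk-next x ys w t t′ e)
    ; t zero (inj₂ (e , _)) → proj₂ (walk-close x ys w t e) })

theorem1p8 : (k n N : ℕ) → 1 ≤ k → 3 ≤ n → n ≤ N →
    (c : Coloring N k) → Symmetric c → Gallai c →
    (Q : Subset k) → (∀ (i : Fin k) → (i ∈ Q) ⇔ HasBigComponent c n i) →
    (n ∸ 1) * ∣ Q ∣ + 2 * n + 2 ≤ N →
    MonoCycle c (2 * n)
theorem1p8 k (suc p) N _ (s≤s 2≤p) n≤N c c-sym gallai Q big large = mono-cycle (goal n≤N)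
  where
  big∈Q : ∀ {l} → HasBigComponent c (suc p) l → l ∈ Q
  big∈Q {l} = Equivalence.from (big l)
  open Main c c-sym gallai p 2≤p Q big∈Q large
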